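{- Let $n\ge 4$ and $g\ge 0$. For $1\le p\le n-1$ let $C_p=(n,1,\ldots,p-1,n-1,p,\ldots,n-2)\in\mathfrak{S}_n$, and let the number of $(p,n-1,n)$-dipoles in an orientable surface of genus $g$ be the number of $n$-cycles $\sigma\in\mathfrak{S}_n$ with $\sigma^{ -1}(n)=n-1$ such that $\sigma C_p$ has exactly $n-2g$ cycles. Then this number equals $(n-2)!\,[t^{n-2g}]D_{n,p}(t)$, where, when $2\le p\le \frac n2$, \begin{align*} D_{n,p}(t)&=\binom{t+n-1}{n}+\sum_{p\le k\le n-p-1}\frac{(n-1)(n-p)}{k(n-k-1)}\binom{t+n-k-1}{n}\\ &\quad+\binom{t}{n}-\sum_{p-1\le k\le n-p-1}\frac{n-p}{(n-k-1)(k+1)}\,t\binom{t+n-k-2}{n-1}, \end{align*} and, when $\frac n2\le p\le n-1$, \begin{align*} D_{n,p}(t)&=\binom{t+n-1}{n}-\sum_{n-p\le k\le p-1}\frac{(n-1)(n-p)}{k(n-k-1)}\binom{t+n-k-1}{n}\\ &\quad+\binom{t}{n}+\sum_{n-p\le k\le p-2}\frac{n-p}{(n-k-1)(k+1)}\,t\binom{t+n-k-2}{n-1}. \end{align*}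
   Context: $\binom{t+a}{r}=\frac{(t+a)(t+a-1)\cdots(t+a-r+1)}{r!}$ is regarded as a polynomial in $t$, and $[t^m]$ denotes coefficient extraction. Combinatorial meaning: a dipole is a 2-cell embedding in an orientable surface of a loopless graph with exactly two vertices, rooted at a vertex and an edge (labelled $n$), with a second distinguished edge (labelled $n-1$), the other edges labelled canonically. $C_p$ is the counterclockwise rotation at the root vertex (root jump, i.e. one plus the number of edges strictly between the root edge and the distinguished edge counterclockwise around the root vertex, equal to $p$) and $\sigma$ is the rotation at the non-root vertex (non-root jump $n-1$); the faces correspond to the cycles of $\sigma C_p$, so by the Euler–Poincaré formula a dipole with $n$ edges and $m$ faces lies on the surface of genus $\frac12(n-m)$.
   Formalization: The second formula is stated only for n/2 < p ≤ n−1; at p = n/2 its sums are empty and it is false (n=4, p=2, g=0 gives 1/6), and that case is covered by the first formula. -}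

module Defs where

open import Data.Bool using (Bool; true; false; if_then_else_; _∧_; not)
open import Data.Nat as ℕ using (ℕ; zero; suc; _∸_; _≡ᵇ_; _≤ᵇ_; _<?_; _!)
open import Data.Integer as ℤ using (ℤ; +_; -[1+_])
open import Data.Rational as ℚ using (ℚ; 0ℚ; 1ℚ; _/_)
open import Data.Fin as Fin using (Fin; toℕ; fromℕ<)
open import Data.Vec as Vec using (Vec; []; _∷_; lookup)
open import Data.List as List using (List; []; _∷_; _++_; map; concatMap; allFin; upTo; foldr; filter; length)
open import Relation.Nullary using (yes; no)

-- interval a b = [a, a+1, …, b-1]  (empty if b ≤ a)
interval : ℕ → ℕ → List ℕ
interval a b = map (a ℕ.+_) (upTo (b ∸ a))

count : {A : Set} → (A → Bool) → List A → ℕ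
count P [] = 0
count P (x ∷ xs) = if P x then suc (count P xs) else count P xs

-- all functions Fin n → Fin n, represented in one-line notation as vectors
allVecs : (n k : ℕ) → List (Vec (Fin n) k)
allVecs n zero = [] ∷ []
allVecs n (suc k) = concatMap (λ i → map (i ∷_) (allVecs n k)) (allFin n)

allB : {A : Set} → (A → Bool) → List A → Bool
allB P [] = true
allB P (x ∷ xs) = P x ∧ allB P xs

iter : {A : Set} → (A → A) → ℕ → A → A
iter f zero x = x
iter f (suc k) x = f (iter f k x)

-- Permutations of {1,…,n}; the label of i : Fin n is toℕ i + 1.

-- f is injective (hence a permutation of the finite set Fin n)
isPerm : {n : ℕ} → (Fin n → Fin n) → Bool
isPerm {n} f = allB (λ i → allB (λ j → if toℕ (f i) ≡ᵇ toℕ (f j) then toℕ i ≡ᵇ toℕ j else true) (allFin n)) (allFin n)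

-- number of cycles of a permutation f of Fin n: the number of i that are the
-- minimum of their orbit {f^k i | k < n}
numCycles : {n : ℕ} → (Fin n → Fin n) → ℕ
numCycles {n} f = count (λ i → allB (λ k → toℕ i ≤ᵇ toℕ (iter f k i)) (upTo n)) (allFin n)

cycleFun : List ℕ → ℕ → ℕ
cycleFun [] x = x
cycleFun (h ∷ t) x = go (h ∷ t)
  where
  go : List ℕ → ℕ
  go [] = x
  go (a ∷ []) = if x ≡ᵇ a then h else x
  go (a ∷ b ∷ rest) = if x ≡ᵇ a then b else go (b ∷ rest)

-- transport a map on labels {1,…,n} to Fin n (labels outside the range are
-- never produced for the cycles used below; fallback: identity)
onLabels : (n : ℕ) → (ℕ → ℕ) → Fin n → Fin n
onLabels n f i with f (suc (toℕ i)) ∸ 1 <? n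
... | yes lt = fromℕ< lt
... | no _ = i

Cp : (n p : ℕ) → Fin n → Fin n
Cp n p = onLabels n (cycleFun (n ∷ (interval 1 p ++ ((n ∸ 1) ∷ interval p (n ∸ 1)))))

-- σ is an n-cycle, σ⁻¹(n) = n-1 (i.e. σ(n-1) = n), and σ C_p has exactly
-- c cycles (composition: (σ C_p)(x) = σ(C_p(x)))
isDipole : (n p : ℕ) → (ℕ → Bool) → Vec (Fin n) n → Bool
isDipole n p cyc σ =
  isPerm (lookup σ)
  ∧ (numCycles (lookup σ) ≡ᵇ 1)
  ∧ allB (λ i → if toℕ i ≡ᵇ (n ∸ 2) then toℕ (lookup σ i) ≡ᵇ (n ∸ 1) else true) (allFin n)
  ∧ cyc (numCycles (λ x → lookup σ (Cp n p x)))

dipoleCount : (n p g : ℕ) → ℕ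
dipoleCount n p g = count (isDipole n p (λ c → (c ℕ.+ 2 ℕ.* g) ≡ᵇ n)) (allVecs n n)

-- Polynomials in t over ℚ as coefficient lists (ascending powers)

Poly : Set
Poly = List ℚ

_⊕_ : Poly → Poly → Poly
[] ⊕ q = q
(a ∷ p) ⊕ [] = a ∷ p
(a ∷ p) ⊕ (b ∷ q) = (a ℚ.+ b) ∷ (p ⊕ q)

scale : ℚ → Poly → Poly
scale c = map (c ℚ.*_)

neg : Poly → Poly
neg = scale (ℚ.- 1ℚ)

mulT : Poly → Poly
mulT p = 0ℚ ∷ p

mulLin : ℚ → Poly → Poly
mulLin c p = mulT p ⊕ scale c p

constP : ℚ → Poly
constP c = c ∷ []

coeffℕ : ℕ → Poly → ℚ
coeffℕ m [] = 0ℚ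
coeffℕ zero (a ∷ p) = a
coeffℕ (suc m) (a ∷ p) = coeffℕ m p

coeff : ℤ → Poly → ℚ
coeff (+ m) p = coeffℕ m p
coeff -[1+ m ] p = 0ℚ

-- rational a/d, with d ≠ 0 in all uses below (fallback 0 for d = 0)
frac : ℤ → ℕ → ℚ
frac a zero = 0ℚ
frac a (suc d) = a / suc d

fromℕq : ℕ → ℚ
fromℕq k = + k / 1

fallingProd : ℤ → ℕ → Poly
fallingProd a zero = constP 1ℚ
fallingProd a (suc r) = mulLin ((a ℤ.- + r) / 1) (fallingProd a r)

binomP : ℤ → ℕ → Poly
binomP a r = scale (frac (+ 1) (r !)) (fallingProd a r)

sumP : List Poly → Poly
sumP = foldr _⊕_ []

termA : ℕ → ℕ → ℕ → Poly
termA n p k = scale (frac (+ ((n ∸ 1) ℕ.* (n ∸ p))) (k ℕ.* (n ∸ k ∸ 1))) (binomP (+ (n ∸ k ∸ 1)) n)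

termB : ℕ → ℕ → ℕ → Poly
termB n p k = scale (frac (+ (n ∸ p)) ((n ∸ k ∸ 1) ℕ.* (k ℕ.+ 1))) (mulT (binomP (+ (n ∸ k ∸ 2)) (n ∸ 1)))

-- case 2 ≤ p ≤ n/2
D₁ : ℕ → ℕ → Poly
D₁ n p =
  binomP (+ (n ∸ 1)) n
  ⊕ (sumP (map (termA n p) (interval p (n ∸ p)))
  ⊕ (binomP (+ 0) n
  ⊕ neg (sumP (map (termB n p) (interval (p ∸ 1) (n ∸ p))))))

-- case n/2 ≤ p ≤ n-1
D₂ : ℕ → ℕ → Poly
D₂ n p =
  binomP (+ (n ∸ 1)) n
  ⊕ (neg (sumP (map (termA n p) (interval (n ∸ p) p)))
  ⊕ (binomP (+ 0) n
  ⊕ sumP (map (termB n p) (interval (n ∸ p) (p ∸ 1)))))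

{-# OPTIONS --safe #-}
module Submission where

-- Write E for the backward shift of t and X k = binom(t+n-1-k, n) = Eᵏ binom(t+n-1, n).  Partial fractions
-- and t binom(t+n-k-2, n-1) = (k+1) X k + (n-k-1) X (k+1) make both sums telescope, so that in either case
-- D_{n,p} = X 0 - X (p-1) - X (n-p) + X (n-1) = (1 - E^(p-1)) (1 - E^(n-p)) binom(t+n-1, n).
--
-- Since σ(n-1) = n, composing σ with the transposition (n-1 n) turns it into an arbitrary cycle on
-- {1,…,n-1}, while the transposition cuts C_p into two cycles, which have lengths p-1 and n-p once n is
-- deleted.  The theorem is thus the case λ = (p-1, n-p) of the following: if κ is a permutation of N points
-- with cycle lengths λ, then the sum of t^cyc(σκ) over all N-cycles σ is (N-1)! ∏(1 - E^λᵢ) binom(t+N, N+1).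
-- This goes by induction on N: every N-cycle is uniquely σ' ∘ (x d), with σ' a cycle on the points other
-- than d, and (x d) ∘ κ arises from κ by cutting the cycle of d at x or by joining it to the cycle of x.

open import Defs
open import Data.Bool using (Bool; true; false; T; if_then_else_; _∧_)
open import Data.Bool.Properties using (T?; ∧-assoc)
open import Data.Unit using (tt)
open import Data.Nat as ℕ using (ℕ; zero; suc; _≤_; _<_; s≤s; z≤n; _∸_; _≡ᵇ_; _≤ᵇ_; _<?_; _!)
import Data.Nat.Properties as ℕ
open import Data.Nat.Induction using (<-rec)
open import Data.Nat.ListAction using (sum)
open import Data.Integer as ℤ using (ℤ; +_)
import Data.Integer.Properties as ℤ
open import Data.Rational as ℚ using (ℚ; 0ℚ; 1ℚ; _/_; toℚᵘ)
import Data.Rational.Properties as ℚ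
open import Data.Rational.Unnormalised using (mkℚᵘ; *≡*; _≃_)
import Data.Rational.Unnormalised.Properties as ℚᵘ
open import Data.Fin as Fin using (Fin; toℕ; fromℕ<)
import Data.Fin.Properties as Fin
open import Data.Vec as Vec using (Vec; []; _∷_; lookup)
import Data.Vec.Properties as Vec
open import Data.List using (List; []; _∷_; _++_; map; concatMap; upTo; applyUpTo; allFin; filter; length; cartesianProductWith)
open import Data.List.Properties as List using (length-++; length-map; length-upTo; map-++; map-applyUpTo; ++-assoc; ++-identityʳ)
open import Data.List.Membership.Propositional using (_∈_; _∉_)
open import Data.List.Membership.Propositional.Properties
open import Data.List.Membership.Propositional.Properties.WithK using (unique∧set⇒bag)
open import Data.List.Relation.Binary.BagAndSetEquality using (∼bag⇒↭)
open import Data.List.Relation.Unary.Any as Any using (here; there)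
open import Data.List.Relation.Unary.All as All using (All; []; _∷_)
import Data.List.Relation.Unary.All.Properties as All
open import Data.List.Relation.Unary.AllPairs as AllPairs using (AllPairs; []; _∷_)
import Data.List.Relation.Unary.AllPairs.Properties as AllPairs
open import Data.List.Relation.Unary.Unique.Propositional using (Unique)
import Data.List.Relation.Unary.Unique.Propositional.Properties as Unique
open import Data.List.Relation.Binary.Permutation.Propositional using (_↭_; prep; swap; ↭-refl; ↭-sym; ↭-trans; ↭-reflexive; ↭⇒↭ₛ)
open import Data.List.Relation.Binary.Permutation.Propositional.Properties as ↭ using (++-comm; ++⁺ˡ; ++⁺ʳ; ↭-length; ↭-empty-inv; drop-∷; ∈-resp-↭; All-resp-↭; shift; shifts)
import Data.List.Relation.Binary.Permutation.Setoid.Properties as ↭ₛ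
open import Data.Product using (_×_; _,_; proj₁; proj₂; ∃)
open import Data.Sum using (_⊎_; inj₁; inj₂)
open import Function using (_∘_; id; mk⇔)
open import Relation.Nullary using (¬_; Dec; yes; no; does; contradiction)
open import Relation.Nullary.Decidable using (dec-true; dec-false)
open import Relation.Binary.Definitions using (DecidableEquality)
open import Relation.Binary.PropositionalEquality

-- Dipoles involve only two parts, but cutting and joining change the number of parts, so the
-- induction has to run over all partitions at once. If d lies in a cycle of length l + 2, one
-- choice of x makes d a fixed point and contributes a factor t, l choices cut the cycle, and the
-- others join it to another cycle. Pascal's rule, y = (1 - E) y⁺ for binomials y and y⁺ of
-- consecutive degrees, settles cuts and joins. The obstacle is t: it does not commute with E, since
-- t y contains a term proportional to the index, and moving it past ∏(1 - E^m) produces error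
-- terms. These are cancelled by terms of the sum over the joins.
--
-- The count of cycles has to survive the removal of a point, so it is computed by deleting points
-- one at a time and counting those that are fixed at that moment. To agree with the count by orbit
-- minima, points are deleted in decreasing order: removing the largest one never changes whether
-- another point is minimal in its orbit.

-- Boolean tests and counting in lists

T-ext : ∀ {a b} → (T a → T b) → (T b → T a) → a ≡ b
T-ext {true} {true} _ _ = refl
T-ext {false} {false} _ _ = refl
T-ext {true} {false} f _ = contradiction (f tt) id
T-ext {false} {true} _ g = contradiction (g tt) id

T-∧⁺ : ∀ {a b} → T a → T b → T (a ∧ b)
T-∧⁺ {true} _ b = b

T-∧⁻ : ∀ {a b} → T (a ∧ b) → T a × T b
T-∧⁻ {true} t = tt , t

allB⁺ : ∀ {X : Set} (P : X → Bool) xs → (∀ {x} → x ∈ xs → T (P x)) → T (allB P xs)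
allB⁺ P [] h = tt
allB⁺ P (x ∷ xs) h = T-∧⁺ (h (here refl)) (allB⁺ P xs (h ∘ there))

allB⁻ : ∀ {X : Set} (P : X → Bool) xs → T (allB P xs) → ∀ {x} → x ∈ xs → T (P x)
allB⁻ P (x ∷ xs) t (here refl) = proj₁ (T-∧⁻ {P x} t)
allB⁻ P (x ∷ xs) t (there x∈) = allB⁻ P xs (proj₂ (T-∧⁻ {P x} t)) x∈

set⇒↭ : ∀ {X : Set} {xs ys : List X} → Unique xs → Unique ys → (∀ {x} → x ∈ xs → x ∈ ys) → (∀ {x} → x ∈ ys → x ∈ xs) → xs ↭ ys
set⇒↭ u v f g = ∼bag⇒↭ (unique∧set⇒bag u v (mk⇔ f g))

count-↭ : ∀ {X : Set} (P : X → Bool) {xs ys} → xs ↭ ys → count P xs ≡ count P ys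
count-↭ P _↭_.refl = refl
count-↭ P (prep x e) = cong (λ c → if P x then suc c else c) (count-↭ P e)
count-↭ P (swap x y e) with P x | P y
... | true | true = cong (suc ∘ suc) (count-↭ P e)
... | true | false = cong suc (count-↭ P e)
... | false | true = cong suc (count-↭ P e)
... | false | false = count-↭ P e
count-↭ P (_↭_.trans e f) = trans (count-↭ P e) (count-↭ P f)

count-++ : ∀ {X : Set} (P : X → Bool) xs ys → count P (xs ++ ys) ≡ count P xs ℕ.+ count P ys
count-++ P [] ys = refl
count-++ P (x ∷ xs) ys with P x
... | true = cong suc (count-++ P xs ys)
... | false = count-++ P xs ys

count-map : ∀ {X Z : Set} (P : Z → Bool) (f : X → Z) xs → count P (map f xs) ≡ count (P ∘ f) xs
count-map P f [] = refl
count-map P f (x ∷ xs) with P (f x)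
... | true = cong suc (count-map P f xs)
... | false = count-map P f xs

count-cong : ∀ {X : Set} {P Q : X → Bool} {xs} → All (λ x → P x ≡ Q x) xs → count P xs ≡ count Q xs
count-cong [] = refl
count-cong {P = P} {Q} {x ∷ _} (e ∷ es) with P x | Q x | e
... | true | true | refl = cong suc (count-cong es)
... | false | false | refl = count-cong es

count-false : ∀ {X : Set} (xs : List X) → count (λ _ → false) xs ≡ 0
count-false [] = refl
count-false (x ∷ xs) = count-false xs

-- Rational arithmetic, coefficient sequences and falling products

module Coefficients where
  open import Data.Rational using (_+_; _*_; _-_; -_)
  open import Data.Rational.Properties hiding (_≟_)
  open import Data.Rational.Solver
  open +-*-Solver
  open ≡-Reasoning

  ζ : ℤ → ℚ
  ζ z = z / 1

  toζ : ∀ z → toℚᵘ (ζ z) ≃ mkℚᵘ z 0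
  toζ z = toℚᵘ-fromℚᵘ (mkℚᵘ z 0)

  ζ-+ : ∀ a b → ζ (a ℤ.+ b) ≡ ζ a + ζ b
  ζ-+ a b = toℚᵘ-injective (ℚᵘ.≃-trans (toζ (a ℤ.+ b)) (ℚᵘ.≃-sym
    (ℚᵘ.≃-trans (toℚᵘ-homo-+ (ζ a) (ζ b)) (ℚᵘ.≃-trans (ℚᵘ.+-cong (toζ a) (toζ b))
      (*≡* (cong (ℤ._* + 1) (cong₂ ℤ._+_ (ℤ.*-identityʳ a) (ℤ.*-identityʳ b))))))))

  ζ-* : ∀ a b → ζ (a ℤ.* b) ≡ ζ a * ζ b
  ζ-* a b = toℚᵘ-injective (ℚᵘ.≃-trans (toζ (a ℤ.* b)) (ℚᵘ.≃-sym
    (ℚᵘ.≃-trans (toℚᵘ-homo-* (ζ a) (ζ b)) (ℚᵘ.≃-trans (ℚᵘ.*-cong (toζ a) (toζ b)) (*≡* refl)))))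

  ζ-neg : ∀ a → ζ (ℤ.- a) ≡ - ζ a
  ζ-neg a = toℚᵘ-injective (ℚᵘ.≃-trans (toζ (ℤ.- a)) (ℚᵘ.≃-sym
    (ℚᵘ.≃-trans (toℚᵘ-homo‿- (ζ a)) (ℚᵘ.-‿cong (toζ a)))))

  ζ-sub : ∀ a b → ζ (a ℤ.- b) ≡ ζ a - ζ b
  ζ-sub a b = trans (ζ-+ a (ℤ.- b)) (cong (λ z → ζ a + z) (ζ-neg b))

  ι : ℕ → ℚ
  ι = fromℕq

  ι-+ : ∀ a b → ι (a ℕ.+ b) ≡ ι a + ι b
  ι-+ a b = ζ-+ (+ a) (+ b)

  ι-suc : ∀ a → ι (suc a) ≡ 1ℚ + ι a
  ι-suc a = ι-+ 1 a

  ι-* : ∀ a b → ι (a ℕ.* b) ≡ ι a * ι b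
  ι-* a b = trans (cong ζ (ℤ.pos-* a b)) (ζ-* (+ a) (+ b))

  frac-cancel : ∀ a d → 1 ≤ d → frac a d * ι d ≡ ζ a
  frac-cancel a (suc d) _ = toℚᵘ-injective (ℚᵘ.≃-trans (toℚᵘ-homo-* (a / suc d) (ι (suc d)))
    (ℚᵘ.≃-trans (ℚᵘ.*-cong (toℚᵘ-fromℚᵘ (mkℚᵘ a d)) (toζ (+ suc d)))
    (ℚᵘ.≃-trans (*≡* eq) (ℚᵘ.≃-sym (toζ a)))))
    where
    eq : a ℤ.* + suc d ℤ.* + 1 ≡ a ℤ.* + (suc d ℕ.* 1)
    eq = trans (ℤ.*-identityʳ _) (cong (λ e → a ℤ.* + e) (sym (ℕ.*-identityʳ (suc d))))

  recip : ℕ → ℚ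
  recip d = frac (+ 1) d

  recip-cancel : ∀ d → 1 ≤ d → recip d * ι d ≡ 1ℚ
  recip-cancel d = frac-cancel (+ 1) d

  -- Inserting `recip k * ι k` and `recip j * ι j`, both equal to one, isolates the fraction times
  -- its denominator. The separated reciprocals are what the partial fractions need later.
  frac-* : ∀ a k j → 1 ≤ k → 1 ≤ j → frac a (k ℕ.* j) ≡ ζ a * recip k * recip j
  frac-* a k j k≥1 j≥1 = begin
    F                                   ≡⟨ solve 1 (λ F → F := F :* (con 1ℚ :* con 1ℚ)) refl F ⟩
    F * (1ℚ * 1ℚ)                       ≡⟨ cong₂ (λ x y → F * (x * y)) (sym (recip-cancel k k≥1)) (sym (recip-cancel j j≥1)) ⟩
    F * ((recip k * ι k) * (recip j * ι j))     ≡⟨ solve 5 (λ F a b c d → F :* ((a :* b) :* (c :* d)) := (F :* (b :* d)) :* a :* c) refl F (recip k) (ι k) (recip j) (ι j) ⟩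
    (F * (ι k * ι j)) * recip k * recip j       ≡⟨ cong (λ x → F * x * recip k * recip j) (sym (ι-* k j)) ⟩
    (F * ι (k ℕ.* j)) * recip k * recip j       ≡⟨ cong (λ x → x * recip k * recip j) (frac-cancel a (k ℕ.* j) (ℕ.*-mono-≤ k≥1 j≥1)) ⟩
    ζ a * recip k * recip j ∎
    where
    F : ℚ
    F = frac a (k ℕ.* j)

  Series : Set
  Series = ℕ → ℚ

  timesT : Series → Series
  timesT f zero = 0ℚ
  timesT f (suc m) = f m

  timesT-cong : ∀ {f g} → f ≗ g → timesT f ≗ timesT g
  timesT-cong eq zero = refl
  timesT-cong eq (suc m) = eq m

  timesT-+ : ∀ f g m → timesT (λ i → f i + g i) m ≡ timesT f m + timesT g m
  timesT-+ f g zero = refl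
  timesT-+ f g (suc m) = refl

  timesT-* : ∀ c f m → timesT (λ i → c * f i) m ≡ c * timesT f m
  timesT-* c f zero = sym (*-zeroʳ c)
  timesT-* c f (suc m) = refl

  coeff-⊕ : ∀ p q m → coeffℕ m (p ⊕ q) ≡ coeffℕ m p + coeffℕ m q
  coeff-⊕ [] q m = sym (+-identityˡ _)
  coeff-⊕ (a ∷ p) [] zero = sym (+-identityʳ _)
  coeff-⊕ (a ∷ p) [] (suc m) = sym (+-identityʳ _)
  coeff-⊕ (a ∷ p) (b ∷ q) zero = refl
  coeff-⊕ (a ∷ p) (b ∷ q) (suc m) = coeff-⊕ p q m

  coeff-scale : ∀ c p m → coeffℕ m (scale c p) ≡ c * coeffℕ m p
  coeff-scale c [] m = sym (*-zeroʳ c)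
  coeff-scale c (a ∷ p) zero = refl
  coeff-scale c (a ∷ p) (suc m) = coeff-scale c p m

  coeff-mulT : ∀ p m → coeffℕ m (mulT p) ≡ timesT (λ i → coeffℕ i p) m
  coeff-mulT p zero = refl
  coeff-mulT p (suc m) = refl

  fall : ℤ → ℕ → Series
  fall a k m = coeffℕ m (fallingProd a k)

  fall-suc : ∀ a k m → fall a (suc k) m ≡ timesT (fall a k) m + ζ (a ℤ.- + k) * fall a k m
  fall-suc a k m = trans (coeff-⊕ (mulT (fallingProd a k)) (scale (ζ (a ℤ.- + k)) (fallingProd a k)) m)
    (cong₂ _+_ (coeff-mulT (fallingProd a k) m) (coeff-scale (ζ (a ℤ.- + k)) (fallingProd a k) m))

  timesT-lin : ∀ c f m → timesT (λ i → timesT f i + c * f i) m ≡ timesT (timesT f) m + c * timesT f m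
  timesT-lin c f m = trans (timesT-+ (timesT f) (λ i → c * f i) m) (cong (λ z → timesT (timesT f) m + z) (timesT-* c f m))

  -- `fallingProd` multiplies by its lowest factor last, so extracting the highest factor, t + a +
  -- 1, takes an induction.
  fall-front : ∀ a k m → fall (a ℤ.+ + 1) (suc k) m ≡ timesT (fall a k) m + (ζ a + 1ℚ) * fall a k m
  fall-front a zero m = trans (fall-suc (a ℤ.+ + 1) zero m)
    (cong (λ z → timesT (fall a 0) m + z * fall a 0 m) (trans (cong ζ (ℤ.+-identityʳ (a ℤ.+ + 1))) (ζ-+ a (+ 1))))
  fall-front a (suc k) m = begin
    fall (a ℤ.+ + 1) (suc (suc k)) m
      ≡⟨ fall-suc (a ℤ.+ + 1) (suc k) m ⟩
    timesT (fall (a ℤ.+ + 1) (suc k)) m + ζ (a ℤ.+ + 1 ℤ.- + suc k) * fall (a ℤ.+ + 1) (suc k) m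
      ≡⟨ cong₂ (λ x y → x + ζ (a ℤ.+ + 1 ℤ.- + suc k) * y) (timesT-cong (fall-front a k) m) (fall-front a k m) ⟩
    timesT (λ i → timesT f i + (ζ a + 1ℚ) * f i) m + ζ (a ℤ.+ + 1 ℤ.- + suc k) * (timesT f m + (ζ a + 1ℚ) * f m)
      ≡⟨ cong₂ (λ x y → x + y * (timesT f m + (ζ a + 1ℚ) * f m)) (timesT-lin (ζ a + 1ℚ) f m) eq ⟩
    timesT (timesT f) m + (ζ a + 1ℚ) * timesT f m + (ζ a - ι k) * (timesT f m + (ζ a + 1ℚ) * f m)
      ≡⟨ solve 5 (λ s2 s f a k → s2 :+ (a :+ con 1ℚ) :* s :+ (a :- k) :* (s :+ (a :+ con 1ℚ) :* f)
                   := s2 :+ (a :- k) :* s :+ (a :+ con 1ℚ) :* (s :+ (a :- k) :* f)) refl (timesT (timesT f) m) (timesT f m) (f m) (ζ a) (ι k) ⟩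
    timesT (timesT f) m + (ζ a - ι k) * timesT f m + (ζ a + 1ℚ) * (timesT f m + (ζ a - ι k) * f m)
      ≡⟨ cong (λ x → x + (ζ a + 1ℚ) * (timesT f m + (ζ a - ι k) * f m)) (timesT-lin (ζ a - ι k) f m) ⟨
    timesT (λ i → timesT f i + (ζ a - ι k) * f i) m + (ζ a + 1ℚ) * (timesT f m + (ζ a - ι k) * f m)
      ≡⟨ cong₂ (λ x y → x + (ζ a + 1ℚ) * y) (timesT-cong fs m) (fs m) ⟨
    timesT (fall a (suc k)) m + (ζ a + 1ℚ) * fall a (suc k) m ∎
    where
    f : Series
    f = fall a k
    eq : ζ (a ℤ.+ + 1 ℤ.- + suc k) ≡ ζ a - ι k
    eq = begin
      ζ (a ℤ.+ + 1 ℤ.- + suc k)     ≡⟨ ζ-sub (a ℤ.+ + 1) (+ suc k) ⟩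
      ζ (a ℤ.+ + 1) - ι (suc k)     ≡⟨ cong₂ _-_ (ζ-+ a (+ 1)) (ι-suc k) ⟩
      (ζ a + 1ℚ) - (1ℚ + ι k)       ≡⟨ solve 2 (λ a k → (a :+ con 1ℚ) :- (con 1ℚ :+ k) := a :- k) refl (ζ a) (ι k) ⟩
      ζ a - ι k ∎
    fs : ∀ i → fall a (suc k) i ≡ timesT f i + (ζ a - ι k) * f i
    fs i = trans (fall-suc a k i) (cong (λ z → timesT f i + z * f i) (ζ-sub a (+ k)))

  -- The binomials binom(t+n-1-k, n) and their recurrences

  rfact : ℕ → ℚ
  rfact n = frac (+ 1) (n !)

  rfact-suc : ∀ n → rfact n ≡ rfact (suc n) * (1ℚ + ι n)
  rfact-suc n = begin
    rfact n                                            ≡⟨ *-identityʳ (rfact n) ⟨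
    rfact n * 1ℚ                                       ≡⟨ cong (rfact n *_) (recip-cancel (suc n !) (ℕ.1≤n! (suc n))) ⟨
    rfact n * (rfact (suc n) * ι (suc n ℕ.* n !))      ≡⟨ cong (λ z → rfact n * (rfact (suc n) * z)) (ι-* (suc n) (n !)) ⟩
    rfact n * (rfact (suc n) * (ι (suc n) * ι (n !)))  ≡⟨ solve 4 (λ a b c d → a :* (b :* (c :* d)) := b :* c :* (a :* d)) refl (rfact n) (rfact (suc n)) (ι (suc n)) (ι (n !)) ⟩
    rfact (suc n) * ι (suc n) * (rfact n * ι (n !))    ≡⟨ cong₂ (λ x y → rfact (suc n) * x * y) (ι-suc n) (recip-cancel (n !) (ℕ.1≤n! n)) ⟩
    rfact (suc n) * (1ℚ + ι n) * 1ℚ                    ≡⟨ *-identityʳ _ ⟩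
    rfact (suc n) * (1ℚ + ι n) ∎

  -- Y n k is the coefficient sequence of binom(t + n - 1 - k, n).
  top : ℕ → ℕ → ℤ
  top n k = + n ℤ.- + 1 ℤ.- + k

  Y : ℕ → ℕ → Series
  Y n k m = coeffℕ m (binomP (top n k) n)

  ζ-top : ∀ n k → ζ (top n k) ≡ ι n - 1ℚ - ι k
  ζ-top n k = trans (ζ-sub (+ n ℤ.- + 1) (+ k)) (cong (_- ι k) (ζ-sub (+ n) (+ 1)))

  top-suc : ∀ n k → top (suc n) k ≡ top n k ℤ.+ + 1
  top-suc n k = begin
    + suc n ℤ.- + 1 ℤ.- + k           ≡⟨ cong (λ z → z ℤ.- + 1 ℤ.- + k) (ℤ.+-comm (+ 1) (+ n)) ⟩
    + n ℤ.+ + 1 ℤ.- + 1 ℤ.- + k       ≡⟨ cong (ℤ._- + k) (ℤ.+-assoc (+ n) (+ 1) (ℤ.- + 1)) ⟩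
    + n ℤ.+ (ℤ.- + 1 ℤ.+ + 1) ℤ.- + k ≡⟨ cong (ℤ._- + k) (ℤ.+-assoc (+ n) (ℤ.- + 1) (+ 1)) ⟨
    + n ℤ.- + 1 ℤ.+ + 1 ℤ.- + k       ≡⟨ ℤ.+-assoc (+ n ℤ.- + 1) (+ 1) (ℤ.- + k) ⟩
    + n ℤ.- + 1 ℤ.+ (+ 1 ℤ.- + k)     ≡⟨ cong (λ z → (+ n ℤ.- + 1) ℤ.+ z) (ℤ.+-comm (+ 1) (ℤ.- + k)) ⟩
    + n ℤ.- + 1 ℤ.+ (ℤ.- + k ℤ.+ + 1) ≡⟨ ℤ.+-assoc (+ n ℤ.- + 1) (ℤ.- + k) (+ 1) ⟨
    top n k ℤ.+ + 1 ∎

  top-suc-suc : ∀ n k → top (suc n) (suc k) ≡ top n k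
  top-suc-suc n k = begin
    top (suc n) (suc k)             ≡⟨ top-suc n (suc k) ⟩
    + n ℤ.- + 1 ℤ.- + suc k ℤ.+ + 1 ≡⟨ ℤ.+-assoc (+ n ℤ.- + 1) (ℤ.- + suc k) (+ 1) ⟩
    + n ℤ.- + 1 ℤ.+ (ℤ.- + suc k ℤ.+ + 1) ≡⟨ cong (λ z → (+ n ℤ.- + 1) ℤ.+ z) (lem k) ⟩
    top n k ∎
    where
    lem : ∀ k → ℤ.- + suc k ℤ.+ + 1 ≡ ℤ.- + k
    lem zero = refl
    lem (suc k) = refl

  -- With R = 1/(n+1)! and f the falling product of n factors from `top n k`, the binomials `Y n k`,
  -- `Y (suc n) k` and `Y (suc n) (suc k)` are R (n+1) f, R (t+n-k) f and R (t-1-k) f. Relations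
  -- among them thus reduce to relations among linear factors.
  Y-fall : ∀ n k m → Y n k m ≡ rfact (suc n) * (1ℚ + ι n) * fall (top n k) n m
  Y-fall n k m = trans (coeff-scale (rfact n) (fallingProd (top n k) n) m) (cong (_* fall (top n k) n m) (rfact-suc n))

  Y-suc : ∀ n k m → Y (suc n) k m ≡ rfact (suc n) * (timesT (fall (top n k) n) m + (ι n - ι k) * fall (top n k) n m)
  Y-suc n k m = trans (coeff-scale (rfact (suc n)) (fallingProd (top (suc n) k) (suc n)) m)
    (cong (rfact (suc n) *_) (trans (cong (λ a → fall a (suc n) m) (top-suc n k))
    (trans (fall-front (top n k) n m) (cong (λ z → timesT (fall (top n k) n) m + z * fall (top n k) n m)
      (trans (cong (_+ 1ℚ) (ζ-top n k)) (solve 2 (λ n k → n :- con 1ℚ :- k :+ con 1ℚ := n :- k) refl (ι n) (ι k)))))))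

  Y-suc-suc : ∀ n k m → Y (suc n) (suc k) m ≡ rfact (suc n) * (timesT (fall (top n k) n) m + (- 1ℚ - ι k) * fall (top n k) n m)
  Y-suc-suc n k m = trans (coeff-scale (rfact (suc n)) (fallingProd (top (suc n) (suc k)) (suc n)) m)
    (cong (rfact (suc n) *_) (trans (cong (λ a → fall a (suc n) m) (top-suc-suc n k))
    (trans (fall-suc (top n k) n m) (cong (λ z → timesT (fall (top n k) n) m + z * fall (top n k) n m)
      (trans (ζ-sub (top n k) (+ n)) (trans (cong (_- ι n) (ζ-top n k)) (solve 2 (λ n k → n :- con 1ℚ :- k :- n := :- con 1ℚ :- k) refl (ι n) (ι k))))))))

  Y-pascal : ∀ n k m → Y n k m ≡ Y (suc n) k m - Y (suc n) (suc k) m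
  Y-pascal n k m = trans (Y-fall n k m) (trans
    (solve 5 (λ R n k s f → R :* (con 1ℚ :+ n) :* f := R :* (s :+ (n :- k) :* f) :- R :* (s :+ (:- con 1ℚ :- k) :* f)) refl
       (rfact (suc n)) (ι n) (ι k) (timesT (fall (top n k) n) m) (fall (top n k) n m))
    (sym (cong₂ _-_ (Y-suc n k m) (Y-suc-suc n k m))))

  -- After division by the common factor this is (n+1) t = (t+n-k) + n (t-1-k) + k (n+1). The last
  -- term depends on the index k, which is why multiplication by t fails to commute with shifts.
  Y-mulT : ∀ n k m → timesT (Y n k) m ≡ Y (suc n) k m + ι n * Y (suc n) (suc k) m + ι k * Y n k m
  Y-mulT n k m = trans (timesT-cong (Y-fall n k) m) (trans (timesT-* (rfact (suc n) * (1ℚ + ι n)) (fall (top n k) n) m) (trans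
    (solve 5 (λ R n k s f → R :* (con 1ℚ :+ n) :* s := R :* (s :+ (n :- k) :* f) :+ n :* (R :* (s :+ (:- con 1ℚ :- k) :* f)) :+ k :* (R :* (con 1ℚ :+ n) :* f)) refl
       (rfact (suc n)) (ι n) (ι k) (timesT (fall (top n k) n) m) (fall (top n k) n m))
    (sym (cong₂ _+_ (cong₂ (λ x y → x + ι n * y) (Y-suc n k m) (Y-suc-suc n k m)) (cong (ι k *_) (Y-fall n k m))))))

  -- Products of the operators 1 - E^m

  -- Φ y μ is ∏ (1 - Eᵐ) y over the parts m of μ, where (E y) j = y (j + 1).
  Φ : (ℕ → ℚ) → List ℕ → ℕ → ℚ
  Φ y [] j = y j
  Φ y (m ∷ μ) j = Φ y μ j - Φ y μ (j ℕ.+ m)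

  Φ-↭ : ∀ y {μ ν} → μ ↭ ν → ∀ j → Φ y μ j ≡ Φ y ν j
  Φ-↭ y _↭_.refl j = refl
  Φ-↭ y (prep m e) j = cong₂ _-_ (Φ-↭ y e j) (Φ-↭ y e (j ℕ.+ m))
  Φ-↭ y (swap {xs = μ} {ys = ν} a b e) j = begin
    (Φ y μ j - Φ y μ (j ℕ.+ b)) - (Φ y μ (j ℕ.+ a) - Φ y μ (j ℕ.+ a ℕ.+ b))
      ≡⟨ cong₂ _-_ (cong₂ _-_ (Φ-↭ y e j) (Φ-↭ y e (j ℕ.+ b))) (cong₂ _-_ (Φ-↭ y e (j ℕ.+ a)) (trans (cong (Φ y μ) comm) (Φ-↭ y e (j ℕ.+ b ℕ.+ a)))) ⟩
    (Φ y ν j - Φ y ν (j ℕ.+ b)) - (Φ y ν (j ℕ.+ a) - Φ y ν (j ℕ.+ b ℕ.+ a))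
      ≡⟨ solve 4 (λ p q r s → (p :- q) :- (r :- s) := (p :- r) :- (q :- s)) refl (Φ y ν j) (Φ y ν (j ℕ.+ b)) (Φ y ν (j ℕ.+ a)) (Φ y ν (j ℕ.+ b ℕ.+ a)) ⟩
    (Φ y ν j - Φ y ν (j ℕ.+ a)) - (Φ y ν (j ℕ.+ b) - Φ y ν (j ℕ.+ b ℕ.+ a)) ∎
    where
    comm : j ℕ.+ a ℕ.+ b ≡ j ℕ.+ b ℕ.+ a
    comm = trans (ℕ.+-assoc j a b) (trans (cong (j ℕ.+_) (ℕ.+-comm a b)) (sym (ℕ.+-assoc j b a)))
  Φ-↭ y (_↭_.trans e f) j = trans (Φ-↭ y e j) (Φ-↭ y f j)

  -- W y μ j = Σ m · Φ y (μ ∖ m) j and V y μ j = Σ m · Φ y (μ ∖ m) (j + m) over the parts m of μ.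
  W V : (ℕ → ℚ) → List ℕ → ℕ → ℚ
  W y [] j = 0ℚ
  W y (m ∷ μ) j = ι m * Φ y μ j + (W y μ j - W y μ (j ℕ.+ m))
  V y [] j = 0ℚ
  V y (m ∷ μ) j = ι m * Φ y μ (j ℕ.+ m) + (V y μ j - V y μ (j ℕ.+ m))

  -- For a single part m, the value of `Φ y (μ ∖ m)` at j minus its value at j + m is `Φ y μ j`; the
  -- weights m add up to `sum μ`.
  W-V : ∀ y μ j → W y μ j ≡ V y μ j + ι (sum μ) * Φ y μ j
  W-V y [] j = sym (trans (+-identityˡ (0ℚ * y j)) (*-zeroˡ (y j)))
  W-V y (m ∷ μ) j = begin
    ι m * Φ y μ j + (W y μ j - W y μ (j ℕ.+ m))
      ≡⟨ cong₂ (λ a b → ι m * Φ y μ j + (a - b)) (W-V y μ j) (W-V y μ (j ℕ.+ m)) ⟩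
    ι m * Φ y μ j + ((V y μ j + ι (sum μ) * Φ y μ j) - (V y μ (j ℕ.+ m) + ι (sum μ) * Φ y μ (j ℕ.+ m)))
      ≡⟨ solve 6 (λ m s a b v w → m :* a :+ ((v :+ s :* a) :- (w :+ s :* b)) := m :* b :+ (v :- w) :+ (m :+ s) :* (a :- b)) refl
           (ι m) (ι (sum μ)) (Φ y μ j) (Φ y μ (j ℕ.+ m)) (V y μ j) (V y μ (j ℕ.+ m)) ⟩
    V y (m ∷ μ) j + (ι m + ι (sum μ)) * Φ y (m ∷ μ) j
      ≡⟨ cong (λ z → V y (m ∷ μ) j + z * Φ y (m ∷ μ) j) (ι-+ m (sum μ)) ⟨
    V y (m ∷ μ) j + ι (sum (m ∷ μ)) * Φ y (m ∷ μ) j ∎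

  Φ-pascal : ∀ {y y⁺} → (∀ j → y j ≡ y⁺ j - y⁺ (suc j)) → ∀ μ j → Φ y μ j ≡ Φ y⁺ μ j - Φ y⁺ μ (suc j)
  Φ-pascal h [] j = h j
  Φ-pascal {y} {y⁺} h (m ∷ μ) j = trans (cong₂ _-_ (Φ-pascal h μ j) (Φ-pascal h μ (j ℕ.+ m)))
    (solve 4 (λ p q r s → (p :- q) :- (r :- s) := (p :- r) :- (q :- s)) refl (Φ y⁺ μ j) (Φ y⁺ μ (suc j)) (Φ y⁺ μ (j ℕ.+ m)) (Φ y⁺ μ (suc j ℕ.+ m)))

  -- Of the operations in the hypothesis only multiplication by the index j does not commute with
  -- shifts: (1 - E^m)(j y) equals j (1 - E^m) y - m E^m y. `V` collects these corrections over all
  -- parts.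
  Φ-mulT : ∀ {s y y⁺} c → (∀ j → s j ≡ y⁺ j + c * y⁺ (suc j) + ι j * y j) →
    ∀ μ j → Φ s μ j ≡ Φ y⁺ μ j + c * Φ y⁺ μ (suc j) + ι j * Φ y μ j - V y μ j
  Φ-mulT {s} {y} {y⁺} c h [] j = trans (h j) (sym (+-identityʳ _))
  Φ-mulT {s} {y} {y⁺} c h (m ∷ μ) j = begin
    Φ s μ j - Φ s μ (j ℕ.+ m)
      ≡⟨ cong₂ _-_ (Φ-mulT c h μ j) (Φ-mulT c h μ (j ℕ.+ m)) ⟩
    (A + c * B + ι j * C - v) - (A' + c * B' + ι (j ℕ.+ m) * C' - v')
      ≡⟨ cong (λ z → (A + c * B + ι j * C - v) - (A' + c * B' + z * C' - v')) (ι-+ j m) ⟩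
    (A + c * B + ι j * C - v) - (A' + c * B' + (ι j + ι m) * C' - v')
      ≡⟨ solve 11 (λ A B C v A' B' C' v' c j m →
          (A :+ c :* B :+ j :* C :- v) :- (A' :+ c :* B' :+ (j :+ m) :* C' :- v') :=
          (A :- A') :+ c :* (B :- B') :+ j :* (C :- C') :- (m :* C' :+ (v :- v'))) refl A B C v A' B' C' v' c (ι j) (ι m) ⟩
    (A - A') + c * (B - B') + ι j * (C - C') - (ι m * C' + (v - v')) ∎
    where
    A B C v A' B' C' v' : ℚ
    A = Φ y⁺ μ j
    B = Φ y⁺ μ (suc j)
    C = Φ y μ j
    v = V y μ j
    A' = Φ y⁺ μ (j ℕ.+ m)
    B' = Φ y⁺ μ (suc j ℕ.+ m)
    C' = Φ y μ (j ℕ.+ m)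
    v' = V y μ (j ℕ.+ m)

  timesT-Φ : ∀ (F : ℕ → Series) μ j m → timesT (λ i → Φ (λ k → F k i) μ j) m ≡ Φ (λ k → timesT (F k) m) μ j
  timesT-Φ F [] j m = refl
  timesT-Φ F (a ∷ μ) j zero = trans refl (cong₂ _-_ (timesT-Φ F μ j zero) (timesT-Φ F μ (j ℕ.+ a) zero))
  timesT-Φ F (a ∷ μ) j (suc m) = refl

  -- Total over the places where a cycle can be cut in two: as the place advances, one piece grows
  -- and the other shrinks.
  splitSum : (ℕ → ℚ) → List ℕ → ℕ → ℕ → ℚ
  splitSum y μ u zero = 0ℚ
  splitSum y μ u (suc v) = Φ y (suc u ∷ suc v ∷ μ) 0 + splitSum y μ (suc u) v

  -- In (1 - E^a)(1 - E^b) with a + b constant, the terms 1 and E^(a+b) are the same in every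
  -- summand, while the terms E^a and E^b telescope by Pascal's rule.
  splitSum-eval : ∀ {y y⁺} → (∀ j → y j ≡ y⁺ j - y⁺ (suc j)) → ∀ μ u v →
    splitSum y μ u v ≡ ι v * (Φ y μ 0 + Φ y μ (suc (u ℕ.+ v))) - (Φ y⁺ μ 1 - Φ y⁺ μ (suc v)) - (Φ y⁺ μ (suc u) - Φ y⁺ μ (suc (u ℕ.+ v)))
  splitSum-eval {y} {y⁺} h μ u zero = sym (begin
    0ℚ * (Φ y μ 0 + Φ y μ (suc (u ℕ.+ 0))) - (Φ y⁺ μ 1 - Φ y⁺ μ 1) - (Φ y⁺ μ (suc u) - Φ y⁺ μ (suc (u ℕ.+ 0)))
      ≡⟨ cong (λ z → 0ℚ * (Φ y μ 0 + Φ y μ (suc (u ℕ.+ 0))) - (Φ y⁺ μ 1 - Φ y⁺ μ 1) - (Φ y⁺ μ (suc u) - Φ y⁺ μ (suc z))) (ℕ.+-identityʳ u) ⟩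
    0ℚ * (Φ y μ 0 + Φ y μ (suc (u ℕ.+ 0))) - (Φ y⁺ μ 1 - Φ y⁺ μ 1) - (Φ y⁺ μ (suc u) - Φ y⁺ μ (suc u))
      ≡⟨ solve 3 (λ a b c → con 0ℚ :* a :- (b :- b) :- (c :- c) := con 0ℚ) refl (Φ y μ 0 + Φ y μ (suc (u ℕ.+ 0))) (Φ y⁺ μ 1) (Φ y⁺ μ (suc u)) ⟩
    0ℚ ∎)
  splitSum-eval {y} {y⁺} h μ u (suc v) = begin
    (Φ y μ 0 - Φ y μ (suc v)) - (Φ y μ (suc u) - Φ y μ (suc u ℕ.+ suc v)) + splitSum y μ (suc u) v
      ≡⟨ cong (λ z → (Φ y μ 0 - Φ y μ (suc v)) - (Φ y μ (suc u) - Φ y μ (suc u ℕ.+ suc v)) + z) (splitSum-eval h μ (suc u) v) ⟩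
    (Φ y μ 0 - Φ y μ (suc v)) - (Φ y μ (suc u) - Φ y μ (suc u ℕ.+ suc v)) +
      (ι v * (Φ y μ 0 + Φ y μ (suc (suc u ℕ.+ v))) - (Φ y⁺ μ 1 - Φ y⁺ μ (suc v)) - (Φ y⁺ μ (suc (suc u)) - Φ y⁺ μ (suc (suc u ℕ.+ v))))
      ≡⟨ cong (λ z → (Φ y μ 0 - Φ y μ (suc v)) - (Φ y μ (suc u) - Φ y μ (suc u ℕ.+ suc v)) +
           (ι v * (Φ y μ 0 + Φ y μ (suc z)) - (Φ y⁺ μ 1 - Φ y⁺ μ (suc v)) - (Φ y⁺ μ (suc (suc u)) - Φ y⁺ μ (suc z)))) (sym (ℕ.+-suc u v)) ⟩
    (p - Φ y μ (suc v)) - (Φ y μ (suc u) - q) + (ι v * (p + q) - (a - b) - (c - d))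
      ≡⟨ cong₂ (λ x z → (p - x) - (z - q) + (ι v * (p + q) - (a - b) - (c - d))) (Φ-pascal h μ (suc v)) (Φ-pascal h μ (suc u)) ⟩
    (p - (b - e)) - ((f - c) - q) + (ι v * (p + q) - (a - b) - (c - d))
      ≡⟨ solve 9 (λ p q a b c d e f v → (p :- (b :- e)) :- ((f :- c) :- q) :+ (v :* (p :+ q) :- (a :- b) :- (c :- d))
           := (con 1ℚ :+ v) :* (p :+ q) :- (a :- e) :- (f :- d)) refl p q a b c d e f (ι v) ⟩
    (1ℚ + ι v) * (p + q) - (a - e) - (f - d)
      ≡⟨ cong (λ z → z * (p + q) - (a - e) - (f - d)) (ι-suc v) ⟨
    ι (suc v) * (p + q) - (a - e) - (f - d) ∎
    where
    p q a b c d e f : ℚ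
    p = Φ y μ 0
    q = Φ y μ (suc (u ℕ.+ suc v))
    a = Φ y⁺ μ 1
    b = Φ y⁺ μ (suc v)
    c = Φ y⁺ μ (suc (suc u))
    d = Φ y⁺ μ (suc (u ℕ.+ suc v))
    e = Φ y⁺ μ (suc (suc v))
    f = Φ y⁺ μ (suc u)

  -- The induction step when d is a fixed point: every x joins d to another cycle, and a part m
  -- offers m choices of x. The part 1 on the right is the cycle of d, and its factor 1 - E lowers
  -- y⁺ to y.
  fixed-identity : ∀ {y y⁺} → (∀ j → y j ≡ y⁺ j - y⁺ (suc j)) → ∀ μ →
    W y μ 0 - V y μ 0 ≡ ι (sum μ) * Φ y⁺ (1 ∷ μ) 0
  fixed-identity {y} {y⁺} h μ = begin
    W y μ 0 - V y μ 0                              ≡⟨ cong (_- V y μ 0) (W-V y μ 0) ⟩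
    V y μ 0 + ι (sum μ) * Φ y μ 0 - V y μ 0        ≡⟨ solve 2 (λ v x → v :+ x :- v := x) refl (V y μ 0) (ι (sum μ) * Φ y μ 0) ⟩
    ι (sum μ) * Φ y μ 0                            ≡⟨ cong (ι (sum μ) *_) (Φ-pascal h μ 0) ⟩
    ι (sum μ) * Φ y⁺ (1 ∷ μ) 0 ∎

  -- The induction step when d lies in a cycle of length l + 2: the first summand belongs to the x
  -- that makes d a fixed point, whence the multiple s of y by t; the second collects the cuts and
  -- the third the joins. The corrections `V y μ 0` and `V y μ (suc l)` from `Φ-mulT` cancel against
  -- the joins.
  nonfixed-identity : ∀ {s y y⁺} → (∀ j → y j ≡ y⁺ j - y⁺ (suc j)) → ∀ μ l →
    (∀ j → s j ≡ y⁺ j + ι (suc (suc l ℕ.+ sum μ)) * y⁺ (suc j) + ι j * y j) →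
    Φ s (suc l ∷ μ) 0 + splitSum y μ 0 l + (W y μ 0 - V y μ (suc l)) ≡ ι (suc l ℕ.+ sum μ) * Φ y⁺ (suc (suc l) ∷ μ) 0
  nonfixed-identity {s} {y} {y⁺} h μ l t = begin
    (Φ s μ 0 - Φ s μ (suc l)) + splitSum y μ 0 l + (W y μ 0 - v')
      ≡⟨ cong₂ _+_ (cong₂ _+_ (cong₂ _-_ (Φ-mulT {s} {y} {y⁺} n t μ 0) (Φ-mulT {s} {y} {y⁺} n t μ (suc l))) (splitSum-eval h μ 0 l)) (cong (_- v') (W-V y μ 0)) ⟩
    ((a + n * b + 0ℚ * Φ y μ 0 - v) - (c + n * d + ι (suc l) * Φ y μ (suc l) - v'))
     + (ι l * (Φ y μ 0 + Φ y μ (suc l)) - (b - c) - (b - c)) + (v + ι (sum μ) * Φ y μ 0 - v')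
      ≡⟨ cong₂ (λ p q → ((a + n * b + 0ℚ * p - v) - (c + n * d + ι (suc l) * q - v')) + (ι l * (p + q) - (b - c) - (b - c)) + (v + ι (sum μ) * p - v'))
           (Φ-pascal h μ 0) (Φ-pascal h μ (suc l)) ⟩
    ((a + n * b + 0ℚ * (a - b) - v) - (c + n * d + ι (suc l) * (c - d) - v')) + (ι l * ((a - b) + (c - d)) - (b - c) - (b - c)) + (v + ι (sum μ) * (a - b) - v')
      ≡⟨ cong₂ (λ n l' → ((a + n * b + 0ℚ * (a - b) - v) - (c + n * d + l' * (c - d) - v')) + (ι l * ((a - b) + (c - d)) - (b - c) - (b - c)) + (v + ι (sum μ) * (a - b) - v'))
           (trans (ι-suc (suc l ℕ.+ sum μ)) (cong (λ z → 1ℚ + z) ιl)) (ι-suc l) ⟩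
    ((a + (1ℚ + (1ℚ + (ι l + ι (sum μ)))) * b + 0ℚ * (a - b) - v) - (c + (1ℚ + (1ℚ + (ι l + ι (sum μ)))) * d + (1ℚ + ι l) * (c - d) - v')) + (ι l * ((a - b) + (c - d)) - (b - c) - (b - c)) + (v + ι (sum μ) * (a - b) - v')
      ≡⟨ solve 8 (λ a b c d v v' l m →
           ((a :+ (con 1ℚ :+ (con 1ℚ :+ (l :+ m))) :* b :+ con 0ℚ :* (a :- b) :- v) :- (c :+ (con 1ℚ :+ (con 1ℚ :+ (l :+ m))) :* d :+ (con 1ℚ :+ l) :* (c :- d) :- v')) :+ (l :* ((a :- b) :+ (c :- d)) :- (b :- c) :- (b :- c)) :+ (v :+ m :* (a :- b) :- v')
           := (con 1ℚ :+ (l :+ m)) :* (a :- d)) refl a b c d v v' (ι l) (ι (sum μ)) ⟩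
    (1ℚ + (ι l + ι (sum μ))) * (a - d)
      ≡⟨ cong (_* (a - d)) ιl ⟨
    ι (suc l ℕ.+ sum μ) * (a - d) ∎
    where
    a b c d v v' n : ℚ
    a = Φ y⁺ μ 0
    b = Φ y⁺ μ 1
    c = Φ y⁺ μ (suc l)
    d = Φ y⁺ μ (suc (suc l))
    v = V y μ 0
    v' = V y μ (suc l)
    n = ι (suc (suc l ℕ.+ sum μ))
    ιl : ι (suc l ℕ.+ sum μ) ≡ 1ℚ + (ι l + ι (sum μ))
    ιl = trans (ι-suc (l ℕ.+ sum μ)) (cong (λ z → 1ℚ + z) (ι-+ l (sum μ)))

  -- Telescoping of the sums in `D₁` and `D₂`

  partialSum : (ℕ → ℚ) → ℕ → ℚ
  partialSum f zero = 0ℚ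
  partialSum f (suc l) = f 0 + partialSum (f ∘ suc) l

  partialSum-snoc : ∀ f l → partialSum f (suc l) ≡ partialSum f l + f l
  partialSum-snoc f zero = trans (+-identityʳ (f 0)) (sym (+-identityˡ (f 0)))
  partialSum-snoc f (suc l) = trans (cong (λ z → f 0 + z) (partialSum-snoc (f ∘ suc) l)) (sym (+-assoc (f 0) (partialSum (f ∘ suc) l) (f (suc l))))

  partialSum-telescope : ∀ α β w l → (∀ i → i < l → α i - β i ≡ w i - w (suc i)) →
    partialSum α l - partialSum β l ≡ w 0 - w l
  partialSum-telescope α β w zero h = solve 1 (λ x → con 0ℚ :- con 0ℚ := x :- x) refl (w 0)
  partialSum-telescope α β w (suc l) h = begin
    α 0 + A - (β 0 + B)         ≡⟨ solve 4 (λ a A b B → a :+ A :- (b :+ B) := (a :- b) :+ (A :- B)) refl (α 0) A (β 0) B ⟩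
    (α 0 - β 0) + (A - B)       ≡⟨ cong₂ _+_ (h 0 (s≤s z≤n)) (partialSum-telescope (α ∘ suc) (β ∘ suc) (w ∘ suc) l (λ i i<l → h (suc i) (s≤s i<l))) ⟩
    (w 0 - w 1) + (w 1 - w (suc l)) ≡⟨ solve 3 (λ a b c → (a :- b) :+ (b :- c) := a :- c) refl (w 0) (w 1) (w (suc l)) ⟩
    w 0 - w (suc l) ∎
    where
    A B : ℚ
    A = partialSum (α ∘ suc) l
    B = partialSum (β ∘ suc) l

  partialSum-cong : ∀ {f g} l → (∀ i → i < l → f i ≡ g i) → partialSum f l ≡ partialSum g l
  partialSum-cong zero h = refl
  partialSum-cong (suc l) h = cong₂ _+_ (h 0 (s≤s z≤n)) (partialSum-cong l (λ i i<l → h (suc i) (s≤s i<l)))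

  coeff-sumP : ∀ m (T : ℕ → Poly) l → coeffℕ m (sumP (applyUpTo T l)) ≡ partialSum (λ i → coeffℕ m (T i)) l
  coeff-sumP m T zero = refl
  coeff-sumP m T (suc l) = trans (coeff-⊕ (T 0) (sumP (applyUpTo (T ∘ suc) l)) m) (cong (λ z → coeffℕ m (T 0) + z) (coeff-sumP m (T ∘ suc) l))

  coeff-sumP-interval : ∀ m (T : ℕ → Poly) a b →
    coeffℕ m (sumP (map T (interval a b))) ≡ partialSum (λ i → coeffℕ m (T (a ℕ.+ i))) (b ∸ a)
  coeff-sumP-interval m T a b = trans
    (cong (λ z → coeffℕ m (sumP z)) (trans (cong (map T) (map-applyUpTo id (a ℕ.+_) (b ∸ a))) (map-applyUpTo (a ℕ.+_) T (b ∸ a))))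
    (coeff-sumP m (λ i → T (a ℕ.+ i)) (b ∸ a))

  top-∸ : ∀ {n k} → k ≤ n → top (suc n) k ≡ + (n ∸ k)
  top-∸ {n} {k} k≤n = trans (ℤ.m-n≡m⊖n n k) (ℤ.⊖-≥ k≤n)

  coeff-neg : ∀ p m → coeffℕ m (neg p) ≡ - coeffℕ m p
  coeff-neg p m = trans (coeff-scale (- 1ℚ) p m) (solve 1 (λ x → (:- con 1ℚ) :* x := :- x) refl (coeffℕ m p))

  suc-∸-∸ : ∀ n k → suc n ∸ k ∸ 1 ≡ n ∸ k
  suc-∸-∸ n k = trans (ℕ.∸-+-assoc (suc n) k 1) (cong (suc n ∸_) (ℕ.+-comm k 1))

  -- Here `suc n` is the number of edges, so n stands for the n - 1 of the formulas. `u` and `v`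
  -- carry the two summands of the partial fraction n/(k(n-k)) = 1/k + 1/(n-k).
  module Terms (n p m : ℕ) where
    q : ℕ
    q = suc n ∸ p
    X u v : ℕ → ℚ
    X k = Y (suc n) k m
    u k = recip k * X k
    v k = recip (n ∸ k) * X k

    termA-coeff : ∀ k → 1 ≤ k → k < n → coeffℕ m (termA (suc n) p k) ≡ ι q * (u k + v k)
    termA-coeff k 1≤k k<n = begin
      coeffℕ m (termA (suc n) p k)
        ≡⟨ coeff-scale (frac (+ (n ℕ.* q)) (k ℕ.* (suc n ∸ k ∸ 1))) (binomP (+ (suc n ∸ k ∸ 1)) (suc n)) m ⟩
      frac (+ (n ℕ.* q)) (k ℕ.* (suc n ∸ k ∸ 1)) * coeffℕ m (binomP (+ (suc n ∸ k ∸ 1)) (suc n))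
        ≡⟨ cong (λ j → frac (+ (n ℕ.* q)) (k ℕ.* j) * coeffℕ m (binomP (+ j) (suc n))) (suc-∸-∸ n k) ⟩
      frac (+ (n ℕ.* q)) (k ℕ.* j) * coeffℕ m (binomP (+ j) (suc n))
        ≡⟨ cong₂ _*_ (frac-* (+ (n ℕ.* q)) k j 1≤k 1≤j) (cong (λ a → coeffℕ m (binomP a (suc n))) (sym (top-∸ (ℕ.<⇒≤ k<n)))) ⟩
      ι (n ℕ.* q) * recip k * recip j * X k
        -- Replacing n by k + (n - k) is the partial fraction decomposition.
        ≡⟨ cong (λ z → z * recip k * recip j * X k) (trans (ι-* n q) (cong (_* ι q) (trans (cong ι (sym (ℕ.m+[n∸m]≡n (ℕ.<⇒≤ k<n)))) (ι-+ k j)))) ⟩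
      (ι k + ι j) * ι q * recip k * recip j * X k
        ≡⟨ solve 6 (λ k j q rk rj X → (k :+ j) :* q :* rk :* rj :* X := q :* (rj :* X :* (rk :* k) :+ rk :* X :* (rj :* j))) refl (ι k) (ι j) (ι q) (recip k) (recip j) (X k) ⟩
      ι q * (recip j * X k * (recip k * ι k) + recip k * X k * (recip j * ι j))
        ≡⟨ cong₂ (λ x y → ι q * (recip j * X k * x + recip k * X k * y)) (recip-cancel k 1≤k) (recip-cancel j 1≤j) ⟩
      ι q * (recip j * X k * 1ℚ + recip k * X k * 1ℚ)
        ≡⟨ solve 3 (λ q a b → q :* (a :* con 1ℚ :+ b :* con 1ℚ) := q :* (b :+ a)) refl (ι q) (recip j * X k) (recip k * X k) ⟩
      ι q * (u k + v k) ∎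
      where
      j : ℕ
      j = n ∸ k
      1≤j : 1 ≤ j
      1≤j = ℕ.m<n⇒0<n∸m k<n

    termB-coeff : ∀ k → k < n → coeffℕ m (termB (suc n) p k) ≡ ι q * (v k + u (suc k))
    termB-coeff k k<n = begin
      coeffℕ m (termB (suc n) p k)
        ≡⟨ coeff-scale (frac (+ q) ((suc n ∸ k ∸ 1) ℕ.* (k ℕ.+ 1))) (mulT (binomP (+ (suc n ∸ k ∸ 2)) n)) m ⟩
      frac (+ q) ((suc n ∸ k ∸ 1) ℕ.* (k ℕ.+ 1)) * coeffℕ m (mulT (binomP (+ (suc n ∸ k ∸ 2)) n))
        ≡⟨ cong₂ _*_ (trans (cong₂ (λ a b → frac (+ q) (a ℕ.* b)) (suc-∸-∸ n k) (ℕ.+-comm k 1)) (frac-* (+ q) j (suc k) 1≤j (s≤s z≤n)))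
             (trans (coeff-mulT (binomP (+ (suc n ∸ k ∸ 2)) n) m) (timesT-cong (λ i → cong (λ a → coeffℕ i (binomP a n)) (lem n k k<n)) m)) ⟩
      ι q * recip j * recip (suc k) * timesT (Y n k) m
        -- `Y-mulT` leaves a binomial of lower degree; Pascal's rule raises it, so that only values
        -- of `X` remain.
        ≡⟨ cong (ι q * recip j * recip (suc k) *_) (trans (Y-mulT n k m) (cong (λ z → X k + ι n * X (suc k) + ι k * z) (Y-pascal n k m))) ⟩
      ι q * recip j * recip (suc k) * (X k + ι n * X (suc k) + ι k * (X k - X (suc k)))
        ≡⟨ cong (λ z → ι q * recip j * recip (suc k) * (X k + z * X (suc k) + ι k * (X k - X (suc k)))) (trans (cong ι (sym (ℕ.m+[n∸m]≡n (ℕ.<⇒≤ k<n)))) (ι-+ k j)) ⟩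
      ι q * recip j * recip (suc k) * (X k + (ι k + ι j) * X (suc k) + ι k * (X k - X (suc k)))
        ≡⟨ solve 7 (λ q rj rk x k j x' → q :* rj :* rk :* (x :+ (k :+ j) :* x' :+ k :* (x :- x')) :=
             q :* (rj :* x :* (rk :* (con 1ℚ :+ k)) :+ rk :* x' :* (rj :* j))) refl (ι q) (recip j) (recip (suc k)) (X k) (ι k) (ι j) (X (suc k)) ⟩
      ι q * (recip j * X k * (recip (suc k) * (1ℚ + ι k)) + recip (suc k) * X (suc k) * (recip j * ι j))
        ≡⟨ cong₂ (λ x y → ι q * (recip j * X k * x + recip (suc k) * X (suc k) * y)) (trans (cong (recip (suc k) *_) (sym (ι-suc k))) (recip-cancel (suc k) (s≤s z≤n))) (recip-cancel j 1≤j) ⟩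
      ι q * (recip j * X k * 1ℚ + recip (suc k) * X (suc k) * 1ℚ)
        ≡⟨ cong₂ (λ x y → ι q * (x + y)) (*-identityʳ (v k)) (*-identityʳ (u (suc k))) ⟩
      ι q * (v k + u (suc k)) ∎
      where
      j : ℕ
      j = n ∸ k
      1≤j : 1 ≤ j
      1≤j = ℕ.m<n⇒0<n∸m k<n
      lem : ∀ n k → k < n → + (suc n ∸ k ∸ 2) ≡ top n k
      lem (suc n) k (s≤s k≤n) = trans (cong +_ (trans (ℕ.∸-+-assoc (2 ℕ.+ n) k 2) (cong (2 ℕ.+ n ∸_) (ℕ.+-comm k 2)))) (sym (top-∸ k≤n))

    termA-termB : ∀ k → 1 ≤ k → k < n → coeffℕ m (termA (suc n) p k) - coeffℕ m (termB (suc n) p k) ≡ ι q * u k - ι q * u (suc k)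
    termA-termB k 1≤k k<n = trans (cong₂ _-_ (termA-coeff k 1≤k k<n) (termB-coeff k k<n))
      (solve 4 (λ q u v w → q :* (u :+ v) :- q :* (v :+ w) := q :* u :- q :* w) refl (ι q) (u k) (v k) (u (suc k)))

    A B : ℕ → ℚ
    A k = coeffℕ m (termA (suc n) p k)
    B k = coeffℕ m (termB (suc n) p k)

    telescope : ∀ a l → 1 ≤ a → a ℕ.+ l ≤ n → partialSum (λ i → A (a ℕ.+ i)) l - partialSum (λ i → B (a ℕ.+ i)) l ≡ ι q * u a - ι q * u (a ℕ.+ l)
    telescope a l 1≤a a+l≤n = trans
      (partialSum-telescope (λ i → A (a ℕ.+ i)) (λ i → B (a ℕ.+ i)) (λ i → ι q * u (a ℕ.+ i)) l
        (λ i i<l → trans (termA-termB (a ℕ.+ i) (ℕ.≤-trans 1≤a (ℕ.m≤m+n a i)) (ℕ.<-≤-trans (ℕ.+-monoʳ-< a i<l) a+l≤n))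
           (cong (λ z → ι q * u (a ℕ.+ i) - ι q * u z) (sym (ℕ.+-suc a i)))))
      (cong (λ z → ι q * u z - ι q * u (a ℕ.+ l)) (ℕ.+-identityʳ a))

    -- An end of the telescope is a multiple q/k of `X k`, and the range of summation puts one end
    -- at k = q. Likewise `q*v` handles the unmatched term, where n - k = q.
    q*u : ∀ k → 1 ≤ k → k ≡ q → ι q * u k ≡ X k
    q*u k 1≤k refl = trans (solve 3 (λ q r x → q :* (r :* x) := (r :* q) :* x) refl (ι k) (recip k) (X k))
      (trans (cong (_* X k) (recip-cancel k 1≤k)) (*-identityˡ (X k)))

    q*v : ∀ k → 1 ≤ q → n ∸ k ≡ q → ι q * v k ≡ X k
    q*v k 1≤q eq = trans (cong (λ z → ι q * (recip z * X k)) eq) (trans (solve 3 (λ q r x → q :* (r :* x) := (r :* q) :* x) refl (ι q) (recip q) (X k))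
      (trans (cong (_* X k) (recip-cancel q 1≤q)) (*-identityˡ (X k))))

    X-top : coeffℕ m (binomP (+ n) (suc n)) ≡ X 0
    X-top = cong (λ a → coeffℕ m (binomP a (suc n))) (sym (top-∸ z≤n))

    X-bot : coeffℕ m (binomP (+ 0) (suc n)) ≡ X n
    X-bot = cong (λ a → coeffℕ m (binomP a (suc n))) (sym (trans (top-∸ (ℕ.≤-refl {n})) (cong +_ (ℕ.n∸n≡0 n))))

  -- The sum of `termB` begins one index earlier than that of `termA`. Its extra term at k = p
  -- consists of q v p, which is X p, and of q u (p+1), which cancels the lower end of the
  -- telescope; the upper end is X (n-p).
  D₁-coeff : ∀ n p m → 1 ≤ p → 2 ℕ.* suc p ≤ suc n →
    coeffℕ m (D₁ (suc n) (suc p)) ≡ Φ (λ k → Y (suc n) k m) (p ∷ n ∸ p ∷ []) 0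
  D₁-coeff n p m 1≤p 2p≤n = begin
    coeffℕ m (D₁ (suc n) (suc p))
      ≡⟨ trans (coeff-⊕ (binomP (+ n) (suc n)) _ m) (cong₂ _+_ X-top
          (trans (coeff-⊕ (sumP (map (termA (suc n) (suc p)) (interval (suc p) (n ∸ p)))) _ m) (cong₂ _+_ (coeff-sumP-interval m (termA (suc n) (suc p)) (suc p) (n ∸ p))
          (trans (coeff-⊕ (binomP (+ 0) (suc n)) _ m) (cong₂ _+_ X-bot
            (trans (coeff-neg (sumP (map (termB (suc n) (suc p)) (interval p (n ∸ p)))) m) (cong -_
              (trans (coeff-sumP-interval m (termB (suc n) (suc p)) p (n ∸ p)) (cong (partialSum (λ i → B (p ℕ.+ i))) len))))))))) ⟩
    X 0 + (SA + (X n + - (B (p ℕ.+ 0) + partialSum (λ i → B (p ℕ.+ suc i)) l)))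
      ≡⟨ cong₂ (λ x y → X 0 + (SA + (X n + - (x + y)))) (trans (cong B (ℕ.+-identityʳ p)) (termB-coeff p p<n))
           (partialSum-cong l (λ i _ → cong B (ℕ.+-suc p i))) ⟩
    X 0 + (SA + (X n + - (ι q * (v p + u (suc p)) + SB)))
      ≡⟨ solve 7 (λ x0 sa sb xn q vp up → x0 :+ (sa :+ (xn :+ :- (q :* (vp :+ up) :+ sb))) := x0 :+ xn :- q :* vp :+ ((sa :- sb) :- q :* up)) refl
          (X 0) SA SB (X n) (ι q) (v p) (u (suc p)) ⟩
    X 0 + X n - ι q * v p + ((SA - SB) - ι q * u (suc p))
      ≡⟨ cong (λ z → X 0 + X n - ι q * v p + (z - ι q * u (suc p))) (telescope (suc p) l (s≤s z≤n) (ℕ.≤-trans (ℕ.≤-reflexive sp+l) (ℕ.m∸n≤m n p))) ⟩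
    X 0 + X n - ι q * v p + ((ι q * u (suc p) - ι q * u (suc p ℕ.+ l)) - ι q * u (suc p))
      ≡⟨ solve 5 (λ x0 xn a b c → x0 :+ xn :- a :+ ((b :- c) :- b) := (x0 :- c) :- (a :- xn)) refl (X 0) (X n) (ι q * v p) (ι q * u (suc p)) (ι q * u (suc p ℕ.+ l)) ⟩
    (X 0 - ι q * u (suc p ℕ.+ l)) - (ι q * v p - X n)
      ≡⟨ cong₂ (λ x y → (X 0 - x) - (y - X n)) (trans (cong (λ z → ι q * u z) sp+l) (q*u (n ∸ p) (ℕ.m<n⇒0<n∸m p<n) refl)) (q*v p (ℕ.m<n⇒0<n∸m p<n) refl) ⟩
    (X 0 - X (n ∸ p)) - (X p - X n)
      ≡⟨ cong (λ z → (X 0 - X (n ∸ p)) - (X p - X z)) (ℕ.m+[n∸m]≡n (ℕ.<⇒≤ p<n)) ⟨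
    Φ X (p ∷ n ∸ p ∷ []) 0 ∎
    where
    open Terms n (suc p) m
    sp≤ : suc p ≤ n ∸ p
    sp≤ = ℕ.m+n≤o⇒m≤o∸n (suc p) (ℕ.≤-pred (ℕ.≤-trans (ℕ.≤-reflexive (cong suc (trans (sym (ℕ.+-suc p p)) (cong (λ z → p ℕ.+ suc z) (sym (ℕ.+-identityʳ p)))))) 2p≤n))
    p<n : p < n
    p<n = ℕ.≤-trans sp≤ (ℕ.m∸n≤m n p)
    l : ℕ
    l = n ∸ p ∸ suc p
    sp+l : suc p ℕ.+ l ≡ n ∸ p
    sp+l = ℕ.m+[n∸m]≡n sp≤
    len : n ∸ p ∸ p ≡ suc l
    len = ℕ.+-∸-assoc 1 sp≤
    SA SB : ℚ
    SA = partialSum (λ i → A (suc p ℕ.+ i)) l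
    SB = partialSum (λ i → B (suc p ℕ.+ i)) l

  -- Now the sum of `termA` has the extra term, at its upper end k = p. Its part q u p cancels the
  -- upper end of the telescope and its part q v p is X p; the lower end gives X (n-p).
  D₂-coeff : ∀ n p m → suc n < 2 ℕ.* suc p → suc p ≤ n →
    coeffℕ m (D₂ (suc n) (suc p)) ≡ Φ (λ k → Y (suc n) k m) (p ∷ n ∸ p ∷ []) 0
  D₂-coeff n p m n<2p p<n = begin
    coeffℕ m (D₂ (suc n) (suc p))
      ≡⟨ trans (coeff-⊕ (binomP (+ n) (suc n)) _ m) (cong₂ _+_ X-top
          (trans (coeff-⊕ (neg (sumP (map (termA (suc n) (suc p)) (interval (n ∸ p) (suc p))))) _ m) (cong₂ _+_
            (trans (coeff-neg (sumP (map (termA (suc n) (suc p)) (interval (n ∸ p) (suc p)))) m) (cong -_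
              (trans (coeff-sumP-interval m (termA (suc n) (suc p)) (n ∸ p) (suc p)) (trans (cong (partialSum (λ i → A (n ∸ p ℕ.+ i))) len)
                (partialSum-snoc (λ i → A (n ∸ p ℕ.+ i)) l)))))
          (trans (coeff-⊕ (binomP (+ 0) (suc n)) _ m) (cong₂ _+_ X-bot
            (coeff-sumP-interval m (termB (suc n) (suc p)) (n ∸ p) p)))))) ⟩
    X 0 + (- (SA + A (n ∸ p ℕ.+ l)) + (X n + SB))
      ≡⟨ cong (λ z → X 0 + (- (SA + z) + (X n + SB))) (trans (cong A np+l) (termA-coeff p 1≤p p<n)) ⟩
    X 0 + (- (SA + ι q * (u p + v p)) + (X n + SB))
      ≡⟨ solve 7 (λ x0 sa sb xn q vp up → x0 :+ (:- (sa :+ q :* (up :+ vp)) :+ (xn :+ sb)) := x0 :+ xn :- q :* vp :- ((sa :- sb) :+ q :* up)) refl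
          (X 0) SA SB (X n) (ι q) (v p) (u p) ⟩
    X 0 + X n - ι q * v p - ((SA - SB) + ι q * u p)
      ≡⟨ cong (λ z → X 0 + X n - ι q * v p - (z + ι q * u p)) (telescope (n ∸ p) l 1≤q (ℕ.≤-trans (ℕ.≤-reflexive np+l) (ℕ.<⇒≤ p<n))) ⟩
    X 0 + X n - ι q * v p - ((ι q * u (n ∸ p) - ι q * u (n ∸ p ℕ.+ l)) + ι q * u p)
      ≡⟨ cong (λ z → X 0 + X n - ι q * v p - ((ι q * u (n ∸ p) - ι q * u z) + ι q * u p)) np+l ⟩
    X 0 + X n - ι q * v p - ((ι q * u (n ∸ p) - ι q * u p) + ι q * u p)
      ≡⟨ solve 5 (λ x0 xn a b c → x0 :+ xn :- a :- ((b :- c) :+ c) := (x0 :- b) :- (a :- xn)) refl (X 0) (X n) (ι q * v p) (ι q * u (n ∸ p)) (ι q * u p) ⟩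
    (X 0 - ι q * u (n ∸ p)) - (ι q * v p - X n)
      ≡⟨ cong₂ (λ x y → (X 0 - x) - (y - X n)) (q*u (n ∸ p) 1≤q refl) (q*v p 1≤q refl) ⟩
    (X 0 - X (n ∸ p)) - (X p - X n)
      ≡⟨ cong (λ z → (X 0 - X (n ∸ p)) - (X p - X z)) (ℕ.m+[n∸m]≡n (ℕ.<⇒≤ p<n)) ⟨
    Φ X (p ∷ n ∸ p ∷ []) 0 ∎
    where
    open Terms n (suc p) m
    1≤q : 1 ≤ q
    1≤q = ℕ.m<n⇒0<n∸m p<n
    np≤ : n ∸ p ≤ p
    np≤ = ℕ.m≤n+o⇒m∸n≤o n p (ℕ.≤-pred (ℕ.≤-pred (ℕ.≤-trans n<2p (ℕ.≤-reflexive (cong suc (trans (cong (λ z → p ℕ.+ suc z) (ℕ.+-identityʳ p)) (ℕ.+-suc p p)))))))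
    1≤p : 1 ≤ p
    1≤p = ℕ.≤-trans 1≤q np≤
    l : ℕ
    l = p ∸ (n ∸ p)
    np+l : n ∸ p ℕ.+ l ≡ p
    np+l = ℕ.m+[n∸m]≡n np≤
    len : suc p ∸ (n ∸ p) ≡ suc l
    len = ℕ.+-∸-assoc 1 np≤
    SA SB : ℚ
    SA = partialSum (λ i → A (n ∸ p ℕ.+ i)) l
    SB = partialSum (λ i → B (n ∸ p ℕ.+ i)) l

  -- Sums over lists and over choices of an entry

  sumOver : {X : Set} → (X → ℚ) → List X → ℚ
  sumOver f [] = 0ℚ
  sumOver f (x ∷ xs) = f x + sumOver f xs

  sumOver-++ : ∀ {X : Set} (f : X → ℚ) xs ys → sumOver f (xs ++ ys) ≡ sumOver f xs + sumOver f ys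
  sumOver-++ f [] ys = sym (+-identityˡ _)
  sumOver-++ f (x ∷ xs) ys = trans (cong (λ z → f x + z) (sumOver-++ f xs ys)) (sym (+-assoc (f x) (sumOver f xs) (sumOver f ys)))

  sumOver-↭ : ∀ {X : Set} (f : X → ℚ) {xs ys} → xs ↭ ys → sumOver f xs ≡ sumOver f ys
  sumOver-↭ f _↭_.refl = refl
  sumOver-↭ f (prep x e) = cong (λ z → f x + z) (sumOver-↭ f e)
  sumOver-↭ f (swap {xs = xs} {ys = ys} x y e) = trans (cong (λ z → f x + (f y + z)) (sumOver-↭ f e))
    (solve 3 (λ a b c → a :+ (b :+ c) := b :+ (a :+ c)) refl (f x) (f y) (sumOver f ys))
  sumOver-↭ f (_↭_.trans e e′) = trans (sumOver-↭ f e) (sumOver-↭ f e′)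

  sumOver-cong : ∀ {X : Set} {f g : X → ℚ} xs → (∀ {x} → x ∈ xs → f x ≡ g x) → sumOver f xs ≡ sumOver g xs
  sumOver-cong [] h = refl
  sumOver-cong (x ∷ xs) h = cong₂ _+_ (h (here refl)) (sumOver-cong xs (h ∘ there))

  sumOver-const : ∀ {X : Set} {f : X → ℚ} {c} xs → (∀ {x} → x ∈ xs → f x ≡ c) → sumOver f xs ≡ ι (length xs) * c
  sumOver-const {c = c} [] h = sym (*-zeroˡ c)
  sumOver-const {f = f} {c} (x ∷ xs) h = trans (cong₂ _+_ (h (here refl)) (sumOver-const xs (h ∘ there)))
    (trans (solve 2 (λ c l → c :+ l :* c := (con 1ℚ :+ l) :* c) refl c (ι (length xs))) (cong (_* c) (sym (ι-suc (length xs)))))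

  -- The summand also receives the entries that were not selected: joining one cycle to that of d
  -- leaves the lengths of all the others as parts of `Φ`.
  sumSelect : {X : Set} → (X → List X → ℚ) → List X → ℚ
  sumSelect g [] = 0ℚ
  sumSelect g (x ∷ xs) = g x xs + sumSelect (λ y ys → g y (x ∷ ys)) xs

  sumSelect-cong : ∀ {X : Set} {g h : X → List X → ℚ} xs → (∀ {y ys} → xs ↭ y ∷ ys → g y ys ≡ h y ys) → sumSelect g xs ≡ sumSelect h xs
  sumSelect-cong [] e = refl
  sumSelect-cong (x ∷ xs) e = cong₂ _+_ (e ↭-refl) (sumSelect-cong xs (λ {y} {ys} p → e (↭-trans (prep x p) (swap x y ↭-refl))))

  sumSelect-map : ∀ {X Z : Set} (f : X → Z) (g : Z → List Z → ℚ) xs → sumSelect (λ y ys → g (f y) (map f ys)) xs ≡ sumSelect g (map f xs)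
  sumSelect-map f g [] = refl
  sumSelect-map f g (x ∷ xs) = cong (λ z → g (f x) (map f xs) + z) (sumSelect-map f (λ y ys → g y (f x ∷ ys)) xs)

  sumSelect-* : ∀ {X : Set} c (g : X → List X → ℚ) xs → sumSelect (λ y ys → c * g y ys) xs ≡ c * sumSelect g xs
  sumSelect-* c g [] = sym (*-zeroʳ c)
  sumSelect-* c g (x ∷ xs) = trans (cong (λ z → c * g x xs + z) (sumSelect-* c (λ y ys → g y (x ∷ ys)) xs)) (sym (*-distribˡ-+ c _ _))

  sumSelect-sub : ∀ {X : Set} (g h : X → List X → ℚ) xs → sumSelect (λ y ys → g y ys - h y ys) xs ≡ sumSelect g xs - sumSelect h xs
  sumSelect-sub g h [] = refl
  sumSelect-sub g h (x ∷ xs) = trans (cong (λ z → g x xs - h x xs + z) (sumSelect-sub (λ y ys → g y (x ∷ ys)) (λ y ys → h y (x ∷ ys)) xs))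
    (solve 4 (λ a b c d → a :- b :+ (c :- d) := (a :+ c) :- (b :+ d)) refl (g x xs) (h x xs) _ _)

  sumOver-concatMap : ∀ {X Z : Set} (f : Z → ℚ) (h : X → List Z) xs → sumOver f (concatMap h xs) ≡ sumSelect (λ y _ → sumOver f (h y)) xs
  sumOver-concatMap f h [] = refl
  sumOver-concatMap f h (x ∷ xs) = trans (sumOver-++ f (h x) (concatMap h xs)) (cong (λ z → sumOver f (h x) + z) (sumOver-concatMap f h xs))

  -- At j = 0 the bracket is `Φ y (k + m ∷ μ′) 0`, the value after a cycle is joined, and m counts
  -- the points at which this can happen. The indices j and k are independent because a part passed
  -- by the induction shifts both.
  sumSelect-Φ : ∀ y μ j k → sumSelect (λ m μ′ → ι m * (Φ y μ′ j - Φ y μ′ (k ℕ.+ m))) μ ≡ W y μ j - V y μ k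
  sumSelect-Φ y [] j k = refl
  sumSelect-Φ y (a ∷ μ) j k = begin
    ι a * (Φ y μ j - Φ y μ (k ℕ.+ a)) + sumSelect (λ m μ′ → ι m * ((Φ y μ′ j - Φ y μ′ (j ℕ.+ a)) - (Φ y μ′ (k ℕ.+ m) - Φ y μ′ (k ℕ.+ m ℕ.+ a)))) μ
      ≡⟨ cong (λ z → ι a * (Φ y μ j - Φ y μ (k ℕ.+ a)) + z) (trans (sumSelect-cong μ (λ {m} {μ′} _ → rearrange m μ′))
           (trans (sumSelect-sub (λ m μ′ → ι m * (Φ y μ′ j - Φ y μ′ (k ℕ.+ m))) (λ m μ′ → ι m * (Φ y μ′ (j ℕ.+ a) - Φ y μ′ (k ℕ.+ a ℕ.+ m))) μ)
             (cong₂ _-_ (sumSelect-Φ y μ j k) (sumSelect-Φ y μ (j ℕ.+ a) (k ℕ.+ a))))) ⟩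
    ι a * (Φ y μ j - Φ y μ (k ℕ.+ a)) + ((W y μ j - V y μ k) - (W y μ (j ℕ.+ a) - V y μ (k ℕ.+ a)))
      ≡⟨ solve 7 (λ a p q w v w′ v′ → a :* (p :- q) :+ ((w :- v) :- (w′ :- v′)) := (a :* p :+ (w :- w′)) :- (a :* q :+ (v :- v′))) refl
           (ι a) (Φ y μ j) (Φ y μ (k ℕ.+ a)) (W y μ j) (V y μ k) (W y μ (j ℕ.+ a)) (V y μ (k ℕ.+ a)) ⟩
    W y (a ∷ μ) j - V y (a ∷ μ) k ∎
    where
    rearrange : ∀ m μ′ → ι m * ((Φ y μ′ j - Φ y μ′ (j ℕ.+ a)) - (Φ y μ′ (k ℕ.+ m) - Φ y μ′ (k ℕ.+ m ℕ.+ a)))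
      ≡ ι m * (Φ y μ′ j - Φ y μ′ (k ℕ.+ m)) - ι m * (Φ y μ′ (j ℕ.+ a) - Φ y μ′ (k ℕ.+ a ℕ.+ m))
    rearrange m μ′ = trans (cong (λ i → ι m * ((Φ y μ′ j - Φ y μ′ (j ℕ.+ a)) - (Φ y μ′ (k ℕ.+ m) - Φ y μ′ i)))
        (trans (ℕ.+-assoc k m a) (trans (cong (k ℕ.+_) (ℕ.+-comm m a)) (sym (ℕ.+-assoc k a m)))))
      (solve 5 (λ m p q r s → m :* ((p :- q) :- (r :- s)) := m :* (p :- r) :- m :* (q :- s)) refl
        (ι m) (Φ y μ′ j) (Φ y μ′ (j ℕ.+ a)) (Φ y μ′ (k ℕ.+ m)) (Φ y μ′ (k ℕ.+ a ℕ.+ m)))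

  count-concatMap : ∀ {X Z : Set} (P : Z → Bool) (h : X → List Z) xs → ι (count P (concatMap h xs)) ≡ sumOver (λ x → ι (count P (h x))) xs
  count-concatMap P h [] = refl
  count-concatMap P h (x ∷ xs) = trans (cong ι (count-++ P (h x) (concatMap h xs))) (trans (ι-+ (count P (h x)) _)
    (cong (λ z → ι (count P (h x)) + z) (count-concatMap P h xs)))

open Coefficients

-- Transpositions, deletion of points and lists of full cycles

module FullCycles {A : Set} (_≟_ : DecidableEquality A) where
  open import Data.List.Membership.DecPropositional _≟_ using (_∈?_)
  open import Data.Rational using (_+_; _*_; _-_; -_)
  open import Data.Rational.Properties hiding (_≟_)
  open import Data.Rational.Solver
  open +-*-Solver
  open ≡-Reasoning

  Inj : (A → A) → Set
  Inj f = ∀ {x y} → f x ≡ f y → x ≡ y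

  swp : A → A → A → A
  swp a b x with x ≟ a
  ... | yes _ = b
  ... | no _ with x ≟ b
  ...   | yes _ = a
  ...   | no _ = x

  swp-l : ∀ a b → swp a b a ≡ b
  swp-l a b with a ≟ a
  ... | yes _ = refl
  ... | no n = contradiction refl n

  swp-r : ∀ a b → swp a b b ≡ a
  swp-r a b with b ≟ a
  ... | yes e = e
  ... | no _ with b ≟ b
  ...   | yes _ = refl
  ...   | no n = contradiction refl n

  swp-other : ∀ {a b x} → x ≢ a → x ≢ b → swp a b x ≡ x
  swp-other {a} {b} {x} x≢a x≢b with x ≟ a
  ... | yes e = contradiction e x≢a
  ... | no _ with x ≟ b
  ...   | yes e = contradiction e x≢b
  ...   | no _ = refl

  swp-involutive : ∀ a b x → swp a b (swp a b x) ≡ x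
  swp-involutive a b x with x ≟ a
  ... | yes refl = swp-r a b
  ... | no x≢a with x ≟ b
  ...   | yes refl = swp-l a b
  ...   | no x≢b = swp-other x≢a x≢b

  swp-injective : ∀ a b → Inj (swp a b)
  swp-injective a b {x} {y} e = trans (sym (swp-involutive a b x)) (trans (cong (swp a b) e) (swp-involutive a b y))

  swp-natural : ∀ {σ} → Inj σ → ∀ a b x → σ (swp a b x) ≡ swp (σ a) (σ b) (σ x)
  swp-natural {σ} inj a b x with x ≟ a
  ... | yes refl = sym (swp-l (σ a) (σ b))
  ... | no x≢a with x ≟ b
  ...   | yes refl = sym (swp-r (σ a) (σ b))
  ...   | no x≢b = sym (swp-other (x≢a ∘ inj) (x≢b ∘ inj))

  -- Takes d out of its cycle, leaving it as a fixed point.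
  del : A → (A → A) → A → A
  del d f x = swp d (f d) (f x)

  del-self : ∀ d f → del d f d ≡ d
  del-self d f = swp-r d (f d)

  del-pred : ∀ {d f x} → f x ≡ d → del d f x ≡ f d
  del-pred {d} {f} e = trans (cong (swp d (f d)) e) (swp-l d (f d))

  del-other : ∀ {d f x} → Inj f → x ≢ d → f x ≢ d → del d f x ≡ f x
  del-other inj x≢d fx≢d = swp-other fx≢d (x≢d ∘ inj)

  del-injective : ∀ {d f} → Inj f → Inj (del d f)
  del-injective {d} {f} inj = inj ∘ swp-injective d (f d)

  FixesOutside : List A → (A → A) → Set
  FixesOutside ds f = ∀ {x} → x ∉ ds → f x ≡ x

  del-fixesOutside : ∀ {d ds f} → Inj f → FixesOutside (d ∷ ds) f → FixesOutside ds (del d f)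
  del-fixesOutside {d} {ds} {f} inj fix {x} x∉ with x ≟ d
  ... | yes refl = del-self d f
  ... | no x≢d = trans (del-other inj x≢d (λ e → x≢d (trans (sym fx) e))) fx
    where
    fx : f x ≡ x
    fx = fix (λ { (here e) → x≢d e ; (there x∈) → x∉ x∈ })

  bit : Bool → ℕ
  bit true = 1
  bit false = 0

  -- The number of cycles of a permutation that moves only points of the list, read off while deleting them.
  cycOn : List A → (A → A) → ℕ
  cycOn [] f = 0
  cycOn (d ∷ ds) f = bit (does (f d ≟ d)) ℕ.+ cycOn ds (del d f)

  del-cong : ∀ d {f g} → f ≗ g → del d f ≗ del d g
  del-cong d e x = cong₂ (swp d) (e d) (e x)

  cycOn-cong : ∀ ds {f g} → f ≗ g → cycOn ds f ≡ cycOn ds g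
  cycOn-cong [] e = refl
  cycOn-cong (d ∷ ds) e = cong₂ ℕ._+_ (cong (λ y → bit (does (y ≟ d))) (e d)) (cycOn-cong ds (del-cong d e))

  -- Since σ fixes d, the point x is the predecessor of d in `σ ∘ swp x d`; a cycle therefore
  -- determines x, and then σ.
  cyclesOn : List A → List (A → A)
  cyclesOn [] = []
  cyclesOn (d ∷ []) = id ∷ []
  cyclesOn (d ∷ ds@(_ ∷ _)) = concatMap (λ x → map (_∘ swp x d) (cyclesOn ds)) ds

  PermOn : List A → (A → A) → Set
  PermOn ds σ = Inj σ × FixesOutside ds σ

  all-concatMap : ∀ {X Y : Set} {P : Y → Set} (h : X → List Y) xs → (∀ {x} → x ∈ xs → All P (h x)) → All P (concatMap h xs)
  all-concatMap h [] _ = []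
  all-concatMap h (x ∷ xs) k = All.++⁺ (k (here refl)) (all-concatMap h xs (k ∘ there))

  cyclesOn-perm : ∀ ds → All (PermOn ds) (cyclesOn ds)
  cyclesOn-perm [] = []
  cyclesOn-perm (d ∷ []) = (id , λ _ → refl) ∷ []
  cyclesOn-perm (d ∷ ds@(_ ∷ _)) = all-concatMap _ ds (λ {x} x∈ → All.map⁺ (All.map (extend x∈) (cyclesOn-perm ds)))
    where
    extend : ∀ {x σ} → x ∈ ds → PermOn ds σ → PermOn (d ∷ ds) (σ ∘ swp x d)
    extend {x} {σ} x∈ (inj , fix) = swp-injective x d ∘ inj , λ {y} y∉ →
      trans (cong σ (swp-other (λ { refl → y∉ (there x∈) }) (y∉ ∘ here))) (fix (y∉ ∘ there))

  -- Conjugation by σ turns the transposition of d and κ d into that of d and σ (κ d), because σ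
  -- fixes d. So deletion of d passes through σ, and the induction can act on κ alone.
  cycOn-∘ : ∀ {d ds σ} → Inj σ → σ d ≡ d → ∀ κ →
    cycOn (d ∷ ds) (σ ∘ κ) ≡ bit (does (κ d ≟ d)) ℕ.+ cycOn ds (σ ∘ del d κ)
  cycOn-∘ {d} {ds} {σ} inj σd κ = cong₂ ℕ._+_ fixed
    (cycOn-cong ds (λ y → sym (trans (swp-natural inj d (κ d) (κ y)) (cong (λ z → swp z (σ (κ d)) (σ (κ y))) σd))))
    where
    fixed : bit (does (σ (κ d) ≟ d)) ≡ bit (does (κ d ≟ d))
    fixed with σ (κ d) ≟ d | κ d ≟ d
    ... | yes _ | yes _ = refl
    ... | no _ | no _ = refl
    ... | yes p | no q = contradiction (inj (trans p (sym σd))) q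
    ... | no p | yes q = contradiction (trans (cong σ q) σd) p

  cyc-count : List A → (A → A) → ℕ → ℕ
  cyc-count ds κ m = count (λ σ → cycOn ds (σ ∘ κ) ≡ᵇ m) (cyclesOn ds)

  Unique-resp-↭ : ∀ {xs ys : List A} → xs ↭ ys → Unique xs → Unique ys
  Unique-resp-↭ e = ↭ₛ.Unique-resp-↭ (setoid A) (↭⇒↭ₛ e)

  -- Cycle decompositions under multiplication by a transposition

  -- The end point stays outside the list, so that a cycle is a path back to its start, and cutting
  -- or joining cycles becomes splitting or appending lists.
  data Path (κ : A → A) : A → List A → A → Set where
    end  : ∀ {a b} → κ a ≡ b → Path κ a [] b
    step : ∀ {a x l b} → κ a ≡ x → Path κ x l b → Path κ a (x ∷ l) b

  Path-++⁻ : ∀ {κ a b x} u {v} → Path κ a (u ++ x ∷ v) b → Path κ a u x × Path κ x v b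
  Path-++⁻ [] (step e p) = end e , p
  Path-++⁻ (_ ∷ u) (step e p) with Path-++⁻ u p
  ... | p₁ , p₂ = step e p₁ , p₂

  Path-++⁺ : ∀ {κ a b x u v} → Path κ a u x → Path κ x v b → Path κ a (u ++ x ∷ v) b
  Path-++⁺ (end e) q = step e q
  Path-++⁺ (step e p) q = step e (Path-++⁺ p q)

  -- A cycle (a l₁ l₂ …) is stored as the pair (a , l), so that it is nonempty by construction.
  Cyc : Set
  Cyc = A × List A

  elems : Cyc → List A
  elems (a , l) = a ∷ l

  len : Cyc → ℕ
  len c = length (elems c)

  IsCycle : (A → A) → Cyc → Set
  IsCycle κ (a , l) = Path κ a l a

  -- A fixed point of κ in `ds` appears as a cycle `(a , [])`, since `covers` accounts for every
  -- point; the lengths therefore form a partition of `length ds`.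
  record CycleDecomposition (κ : A → A) (ds : List A) (cs : List Cyc) : Set where
    field
      injective : Inj κ
      unique    : Unique ds
      covers    : concatMap elems cs ↭ ds
      cycles    : All (IsCycle κ) cs

  open CycleDecomposition

  rotate : ∀ {κ d} r → IsCycle κ r → d ∈ elems r → ∃ λ c → IsCycle κ (d , c) × d ∷ c ↭ elems r
  rotate (a , l) p (here refl) = l , p , ↭-refl
  rotate {d = d} (a , l) p (there d∈) with ∈-∃++ d∈
  ... | u , v , refl with Path-++⁻ u p
  ...   | p₁ , p₂ = v ++ a ∷ u , Path-++⁺ p₂ p₁ , ++-comm (d ∷ v) (a ∷ u)

  concatMap-↭ : ∀ {xs ys : List Cyc} → xs ↭ ys → concatMap elems xs ↭ concatMap elems ys
  concatMap-↭ _↭_.refl = ↭-refl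
  concatMap-↭ (prep x e) = ++⁺ˡ (elems x) (concatMap-↭ e)
  concatMap-↭ (swap x y e) = ↭-trans (shifts (elems x) (elems y)) (++⁺ˡ (elems y) (++⁺ˡ (elems x) (concatMap-↭ e)))
  concatMap-↭ (_↭_.trans e f) = ↭-trans (concatMap-↭ e) (concatMap-↭ f)

  locate : ∀ {d} cs → d ∈ concatMap elems cs → ∃ λ r → ∃ λ rs → cs ↭ r ∷ rs × d ∈ elems r
  locate (r ∷ cs) d∈ with ∈-++⁻ (elems r) d∈
  ... | inj₁ d∈r = r , cs , ↭-refl , d∈r
  ... | inj₂ d∈cs with locate cs d∈cs
  ...   | r′ , rs , e , d∈r′ = r′ , r ∷ rs , ↭-trans (prep r e) (swap r r′ ↭-refl) , d∈r′

  decomposition-↭ : ∀ {κ ds cs cs′} → cs ↭ cs′ → CycleDecomposition κ ds cs → CycleDecomposition κ ds cs′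
  decomposition-↭ e R = record { injective = injective R ; unique = unique R
    ; covers = ↭-trans (concatMap-↭ (↭-sym e)) (covers R) ; cycles = All-resp-↭ e (cycles R) }

  decomposition-rotate : ∀ {κ ds r c rs} → elems c ↭ elems r → IsCycle κ c →
    CycleDecomposition κ ds (r ∷ rs) → CycleDecomposition κ ds (c ∷ rs)
  decomposition-rotate {rs = rs} e p R = record { injective = injective R ; unique = unique R
    ; covers = ↭-trans (++⁺ʳ (concatMap elems rs) e) (covers R) ; cycles = p ∷ All.tail (cycles R) }

  -- Moving the cycle of d to the front and starting it at d only permutes the lengths, and `Φ` is
  -- invariant under that.
  decomposition-at : ∀ {κ d ds cs} → CycleDecomposition κ ds cs → d ∈ ds →
    ∃ λ c → ∃ λ rs → CycleDecomposition κ ds ((d , c) ∷ rs) × map len cs ↭ suc (length c) ∷ map len rs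
  decomposition-at {cs = cs} R d∈ with locate cs (∈-resp-↭ (↭-sym (covers R)) d∈)
  ... | r , rs , e , d∈r with rotate r (All.head (All-resp-↭ e (cycles R))) d∈r
  ...   | c , p , e′ = c , rs , decomposition-rotate e′ p (decomposition-↭ e R) ,
          ↭-trans (↭.map⁺ len e) (↭-reflexive (cong (_∷ map len rs) (sym (↭-length e′))))

  -- Away from d, `κ′` differs from κ in at most two arrows: the one into d is redirected to x, and
  -- the one into x to `κₓ d`. The latter is x if d is a fixed point, and the successor of d if that
  -- is neither d nor x.
  module Surgery {κ : A → A} (inj : Inj κ) {d x : A} (x≢d : x ≢ d) where
    κₓ κ′ : A → A
    κₓ = swp x d ∘ κ
    κ′ = del d κₓ

    κₓ-injective : Inj κₓ
    κₓ-injective = inj ∘ swp-injective x d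

    κ′-injective : Inj κ′
    κ′-injective = del-injective κₓ-injective

    κ′-unaffected : ∀ {y} → y ≢ d → κ y ≢ x → κ y ≢ d → κ′ y ≡ κ y
    κ′-unaffected y≢d κy≢x κy≢d = trans (del-other κₓ-injective y≢d (λ e → κy≢d (trans (sym eq) e))) eq
      where
      eq = swp-other κy≢x κy≢d

    κ′-to-d : ∀ {y} → y ≢ d → κ y ≡ d → κ′ y ≡ x
    κ′-to-d y≢d κy≡d = trans (del-other κₓ-injective y≢d (λ e → x≢d (trans (sym eq) e))) eq
      where
      eq = trans (cong (swp x d) κy≡d) (swp-r x d)

    κ′-to-x : ∀ {y} → κ y ≡ x → κ′ y ≡ κₓ d
    κ′-to-x {y} κy≡x = del-pred {d} {κₓ} {y} (trans (cong (swp x d) κy≡x) (swp-l x d))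

    Away : A → Set
    Away z = z ≢ x × z ≢ d

    -- The inner points avoid x and d, so only the last arrow of the path can change.
    retarget : ∀ {a l b b′} → a ≢ d → (∀ {z} → z ∈ l → Away z) → (∀ {y} → y ≢ d → κ y ≡ b → κ′ y ≡ b′) →
      Path κ a l b → Path κ′ a l b′
    retarget a≢d away h (end e) = end (h a≢d e)
    retarget a≢d away h (step refl p) with away (here refl)
    ... | z≢x , z≢d = step (κ′-unaffected a≢d z≢x z≢d) (retarget z≢d (away ∘ there) h p)

    retarget-cycle : ∀ {r} → (∀ {z} → z ∈ elems r → Away z) → IsCycle κ r → IsCycle κ′ r
    retarget-cycle away = retarget (proj₂ (away (here refl))) (away ∘ there)
      (λ y≢d e → trans (κ′-unaffected y≢d (proj₁ (away (here refl)) ∘ trans (sym e)) (proj₂ (away (here refl)) ∘ trans (sym e))) e)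

    retarget-cycles : ∀ {rs} → (∀ {z} → z ∈ concatMap elems rs → Away z) → All (IsCycle κ) rs → All (IsCycle κ′) rs
    retarget-cycles away [] = []
    retarget-cycles {r ∷ rs} away (p ∷ ps) = retarget-cycle (away ∘ ∈-++⁺ˡ) p ∷ retarget-cycles (away ∘ ∈-++⁺ʳ (elems r)) ps

    κₓd-fixed : κ d ≡ d → κₓ d ≡ x
    κₓd-fixed e = trans (cong (swp x d) e) (swp-r x d)

    away-from : ∀ {ds zs} → Unique (d ∷ ds) → x ∷ zs ↭ ds → ∀ {z} → z ∈ zs → Away z
    away-from (d∉ds ∷ ds!) e z∈ with Unique-resp-↭ (↭-sym e) ds!
    ... | x∉ ∷ _ = (λ { refl → All.lookup x∉ z∈ refl }) , (λ { refl → All.lookup d∉ds (∈-resp-↭ e (there z∈)) refl })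

  decomposition-tail : ∀ {κ d c rs ds} → CycleDecomposition κ (d ∷ ds) ((d , c) ∷ rs) → c ++ concatMap elems rs ↭ ds
  decomposition-tail R = drop-∷ (covers R)

  Unique-tail : ∀ {d : A} {ds} → Unique (d ∷ ds) → Unique ds
  Unique-tail (_ ∷ u) = u

  ∈-tail-≢ : ∀ {d ds} → Unique (d ∷ ds) → ∀ {x : A} → x ∈ ds → x ≢ d
  ∈-tail-≢ (d∉ ∷ _) x∈ refl = All.lookup d∉ x∈ refl

  -- Here x is the successor of d, so `swp x d ∘ κ` fixes d. The arrow that entered d goes to x and
  -- closes the remainder of the cycle.
  cut-first : ∀ {κ d ds x c rs} → CycleDecomposition κ (d ∷ ds) ((d , x ∷ c) ∷ rs) →
    swp x d (κ d) ≡ d × CycleDecomposition (del d (swp x d ∘ κ)) ds ((x , c) ∷ rs)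
  cut-first {κ} {d} {ds} {x} {c} {rs} R with cycles R
  ... | step κd p ∷ ps = trans (cong (swp x d) κd) (swp-l x d) , record
    { injective = κ′-injective ; unique = Unique-tail (unique R) ; covers = decomposition-tail R
    ; cycles = retarget x≢d (away ∘ ∈-++⁺ˡ) κ′-to-d p ∷ retarget-cycles (away ∘ ∈-++⁺ʳ c) ps }
    where
    x≢d : x ≢ d
    x≢d = ∈-tail-≢ (unique R) (∈-resp-↭ (decomposition-tail R) (here refl))
    open Surgery (injective R) x≢d
    away : ∀ {z} → z ∈ c ++ concatMap elems rs → Away z
    away = away-from (unique R) (decomposition-tail R)

  -- The arrow that entered x returns to b, the successor of d, and the arrow that entered d goes to
  -- x; this closes two cycles.
  cut : ∀ {κ d ds b u x v rs} → CycleDecomposition κ (d ∷ ds) ((d , b ∷ u ++ x ∷ v) ∷ rs) →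
    swp x d (κ d) ≢ d × CycleDecomposition (del d (swp x d ∘ κ)) ds ((b , u) ∷ (x , v) ∷ rs)
  cut {κ} {d} {ds} {b} {u} {x} {v} {rs} R with cycles R
  ... | step κd p ∷ ps with Path-++⁻ u p
  ...   | p₁ , p₂ = (λ e → proj₂ b-away (trans (sym κₓd) e)) , record
    { injective = κ′-injective ; unique = Unique-tail (unique R)
    ; covers = ↭-trans (↭-reflexive (sym (List.++-assoc (b ∷ u) (x ∷ v) (concatMap elems rs)))) (decomposition-tail R)
    ; cycles = retarget (proj₂ b-away) (away ∘ there ∘ ∈-++⁺ˡ) (λ _ e → trans (κ′-to-x e) κₓd) p₁
             ∷ retarget x≢d (away ∘ ∈-++⁺ʳ (b ∷ u) ∘ ∈-++⁺ˡ) κ′-to-d p₂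
             ∷ retarget-cycles (away ∘ ∈-++⁺ʳ (b ∷ u) ∘ ∈-++⁺ʳ v) ps }
    where
    parts : (b ∷ u) ++ x ∷ (v ++ concatMap elems rs) ↭ ds
    parts = ↭-trans (↭-reflexive (sym (List.++-assoc (b ∷ u) (x ∷ v) (concatMap elems rs)))) (decomposition-tail R)
    x≢d : x ≢ d
    x≢d = ∈-tail-≢ (unique R) (∈-resp-↭ parts (∈-++⁺ʳ (b ∷ u) (here refl)))
    open Surgery (injective R) x≢d
    away : ∀ {z} → z ∈ (b ∷ u) ++ (v ++ concatMap elems rs) → Away z
    away = away-from (unique R) (↭-trans (↭-sym (shift x (b ∷ u) _)) parts)
    b-away : Away b
    b-away = away (here refl)
    κₓd : κₓ d ≡ b
    κₓd = trans (cong (swp x d) κd) (swp-other (proj₁ b-away) (proj₂ b-away))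

  -- Instead of returning to d, the first cycle goes on to x and runs through the second one, whose
  -- arrow back into x leads to the successor of d. If d is a fixed point, `κₓ d` is x and the
  -- second cycle stays as it was.
  paste : ∀ {κ d ds c r rs x} → CycleDecomposition κ (d ∷ ds) ((d , c) ∷ r ∷ rs) → x ∈ elems r →
    swp x d (κ d) ≢ d × (∃ λ s → len s ≡ length c ℕ.+ len r × CycleDecomposition (del d (swp x d ∘ κ)) ds (s ∷ rs))
  paste {κ} {d} {ds} {c} {r} {rs} {x} R x∈r with cycles R
  ... | p ∷ q ∷ ps with rotate r q x∈r
  ...   | r′ , q′ , e = result c p covers′
    where
    covers′ : c ++ (x ∷ r′) ++ concatMap elems rs ↭ ds
    covers′ = ↭-trans (++⁺ˡ c (++⁺ʳ (concatMap elems rs) e)) (decomposition-tail R)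
    x≢d : x ≢ d
    x≢d = ∈-tail-≢ (unique R) (∈-resp-↭ covers′ (∈-++⁺ʳ c (here refl)))
    open Surgery (injective R) x≢d
    result : ∀ c → Path κ d c d → c ++ (x ∷ r′) ++ concatMap elems rs ↭ ds →
      κₓ d ≢ d × (∃ λ s → len s ≡ length c ℕ.+ len r × CycleDecomposition κ′ ds (s ∷ rs))
    result [] (end κd) cov = (λ e → x≢d (trans (sym (κₓd-fixed κd)) e)) , (x , r′) , ↭-length e , record
      { injective = κ′-injective ; unique = Unique-tail (unique R) ; covers = cov
      ; cycles = retarget x≢d (away ∘ ∈-++⁺ˡ) (λ _ e → trans (κ′-to-x e) (κₓd-fixed κd)) q′
               ∷ retarget-cycles (away ∘ ∈-++⁺ʳ r′) ps }
      where
      away : ∀ {z} → z ∈ r′ ++ concatMap elems rs → Away z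
      away = away-from (unique R) cov
    result (b ∷ c) (step κd p) cov = (λ e → proj₂ b-away (trans (sym κₓd) e)) , (b , c ++ x ∷ r′) ,
      cong suc (trans (length-++ c) (cong (length c ℕ.+_) (↭-length e))) , record
      { injective = κ′-injective ; unique = Unique-tail (unique R)
      ; covers = ↭-trans (↭-reflexive (List.++-assoc (b ∷ c) (x ∷ r′) (concatMap elems rs))) cov
      ; cycles = Path-++⁺ (retarget (proj₂ b-away) (away ∘ there ∘ ∈-++⁺ˡ) κ′-to-d p)
                          (retarget x≢d (away ∘ ∈-++⁺ʳ (b ∷ c) ∘ ∈-++⁺ˡ) (λ _ e → trans (κ′-to-x e) κₓd) q′)
               ∷ retarget-cycles (away ∘ ∈-++⁺ʳ (b ∷ c) ∘ ∈-++⁺ʳ r′) ps }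
      where
      away : ∀ {z} → z ∈ (b ∷ c) ++ (r′ ++ concatMap elems rs) → Away z
      away = away-from (unique R) (↭-trans (↭-sym (shift x (b ∷ c) _)) cov)
      b-away : Away b
      b-away = away (here refl)
      κₓd : κₓ d ≡ b
      κₓd = trans (cong (swp x d) κd) (swp-other (proj₁ b-away) (proj₂ b-away))

  -- Induction on the number of points

  cycSeries : List A → (A → A) → Series
  cycSeries ds κ m = ι (cyc-count ds κ m)

  timesTIf : Bool → Series → Series
  timesTIf true f = timesT f
  timesTIf false f = f

  -- Every σ in `cyclesOn ds` fixes d, so whether d is a cycle of `σ ∘ κ` by itself depends on κ
  -- alone. If it is, each count rises by one, which is a factor t.
  cycOn-extend : ∀ {d ds} → d ∉ ds → ∀ κ m →
    ι (count (λ σ → cycOn (d ∷ ds) (σ ∘ κ) ≡ᵇ m) (cyclesOn ds)) ≡ timesTIf (does (κ d ≟ d)) (cycSeries ds (del d κ)) m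
  cycOn-extend {d} {ds} d∉ κ m = trans (cong ι (count-cong (All.map (λ { (inj , fix) → cong (_≡ᵇ m) (cycOn-∘ {ds = ds} inj (fix d∉) κ) }) (cyclesOn-perm ds)))) (shape (does (κ d ≟ d)) m)
    where
    shape : ∀ b m → ι (count (λ σ → (bit b ℕ.+ cycOn ds (σ ∘ del d κ)) ≡ᵇ m) (cyclesOn ds)) ≡ timesTIf b (cycSeries ds (del d κ)) m
    shape false m = refl
    shape true zero = cong ι (count-false (cyclesOn ds))
    shape true (suc m) = refl

  ∉-head : ∀ {d : A} {ds} → Unique (d ∷ ds) → d ∉ ds
  ∉-head (d≢ ∷ _) d∈ = All.lookup d≢ d∈ refl

  sum-len : ∀ cs → sum (map len cs) ≡ length (concatMap elems cs)
  sum-len [] = refl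
  sum-len (c ∷ cs) = trans (cong (len c ℕ.+_) (sum-len cs)) (sym (length-++ (elems c)))

  module Step {κ : A → A} {d e : A} {es : List A} {c : List A} {rs : List Cyc}
    (R : CycleDecomposition κ (d ∷ e ∷ es) ((d , c) ∷ rs))
    (IH : ∀ κ cs → CycleDecomposition κ (e ∷ es) cs → ∀ m →
      cycSeries (e ∷ es) κ m ≡ ι (length es !) * Φ (λ k → Y (suc (length (e ∷ es))) k m) (map len cs) 0)
    where
    ds : List A
    ds = e ∷ es
    N : ℕ
    N = length ds
    K : ℚ
    K = ι (length es !)
    μ : List ℕ
    μ = map len rs

    size : length c ℕ.+ sum μ ≡ N
    size = trans (cong (length c ℕ.+_) (sum-len rs)) (trans (sym (length-++ c)) (↭-length (decomposition-tail R)))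

    -- The contribution of the full cycles in which x precedes d, in the form that `cycOn-extend`
    -- gives it.
    G : ℕ → A → ℚ
    G m x = timesTIf (does (swp x d (κ d) ≟ d)) (cycSeries ds (del d (swp x d ∘ κ))) m

    module _ (m : ℕ) where
      y s y⁺ : ℕ → ℚ
      y k = Y (suc N) k m
      s k = timesT (Y (suc N) k) m
      y⁺ k = Y (suc (suc N)) k m

      pascal : ∀ j → y j ≡ y⁺ j - y⁺ (suc j)
      pascal j = Y-pascal (suc N) j m

      cycSeries-step : cycSeries (d ∷ ds) κ m ≡ sumOver (G m) c + sumOver (G m) (concatMap elems rs)
      cycSeries-step = begin
        cycSeries (d ∷ ds) κ m
          ≡⟨ count-concatMap (λ σ → cycOn (d ∷ ds) (σ ∘ κ) ≡ᵇ m) (λ x → map (_∘ swp x d) (cyclesOn ds)) ds ⟩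
        sumOver (λ x → ι (count (λ σ → cycOn (d ∷ ds) (σ ∘ κ) ≡ᵇ m) (map (_∘ swp x d) (cyclesOn ds)))) ds
          ≡⟨ sumOver-cong ds (λ {x} _ → trans (cong ι (count-map (λ σ → cycOn (d ∷ ds) (σ ∘ κ) ≡ᵇ m) (_∘ swp x d) (cyclesOn ds)))
               (cycOn-extend (∉-head (unique R)) (swp x d ∘ κ) m)) ⟩
        sumOver (G m) ds
          ≡⟨ sumOver-↭ (G m) (decomposition-tail R) ⟨
        sumOver (G m) (c ++ concatMap elems rs)
          ≡⟨ sumOver-++ (G m) c (concatMap elems rs) ⟩
        sumOver (G m) c + sumOver (G m) (concatMap elems rs) ∎

      G-moved : ∀ {x cs} → swp x d (κ d) ≢ d → CycleDecomposition (del d (swp x d ∘ κ)) ds cs → G m x ≡ K * Φ y (map len cs) 0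
      G-moved {x} {cs} n R′ = trans (cong (λ b → timesTIf b (cycSeries ds (del d (swp x d ∘ κ))) m) (dec-false (swp x d (κ d) ≟ d) n)) (IH _ cs R′ m)

      G-fixed : ∀ {x cs} → swp x d (κ d) ≡ d → CycleDecomposition (del d (swp x d ∘ κ)) ds cs → G m x ≡ K * Φ s (map len cs) 0
      G-fixed {x} {cs} eq R′ = begin
        G m x
          ≡⟨ cong (λ b → timesTIf b (cycSeries ds (del d (swp x d ∘ κ))) m) (dec-true (swp x d (κ d) ≟ d) eq) ⟩
        timesT (cycSeries ds (del d (swp x d ∘ κ))) m
          ≡⟨ timesT-cong (IH _ cs R′) m ⟩
        timesT (λ i → K * Φ (λ k → Y (suc N) k i) (map len cs) 0) m
          ≡⟨ timesT-* K (λ i → Φ (λ k → Y (suc N) k i) (map len cs) 0) m ⟩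
        K * timesT (λ i → Φ (λ k → Y (suc N) k i) (map len cs) 0) m
          ≡⟨ cong (K *_) (timesT-Φ (Y (suc N)) (map len cs) 0 m) ⟩
        K * Φ s (map len cs) 0 ∎

      paste-sum : sumOver (G m) (concatMap elems rs) ≡ K * (W y μ 0 - V y μ (length c))
      paste-sum = begin
        sumOver (G m) (concatMap elems rs)
          ≡⟨ sumOver-concatMap (G m) elems rs ⟩
        sumSelect (λ r _ → sumOver (G m) (elems r)) rs
          ≡⟨ sumSelect-cong rs (λ {r} {rs′} e → each r rs′ e) ⟩
        sumSelect (λ r rs′ → K * h (len r) (map len rs′)) rs
          ≡⟨ sumSelect-* K (λ r rs′ → h (len r) (map len rs′)) rs ⟩
        K * sumSelect (λ r rs′ → h (len r) (map len rs′)) rs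
          ≡⟨ cong (K *_) (trans (sumSelect-map len h rs) (sumSelect-Φ y μ 0 (length c))) ⟩
        K * (W y μ 0 - V y μ (length c)) ∎
        where
        h : ℕ → List ℕ → ℚ
        h l μ′ = ι l * (Φ y μ′ 0 - Φ y μ′ (length c ℕ.+ l))
        each : ∀ r rs′ → rs ↭ r ∷ rs′ → sumOver (G m) (elems r) ≡ K * h (len r) (map len rs′)
        -- All points of r lead to the same lengths, whence the factor `ι (len r)`.
        each r rs′ e = trans (sumOver-const (elems r) term)
          (solve 3 (λ l K p → l :* (K :* p) := K :* (l :* p)) refl (ι (len r)) K (Φ y (length c ℕ.+ len r ∷ map len rs′) 0))
          where
          term : ∀ {x} → x ∈ elems r → G m x ≡ K * Φ y (length c ℕ.+ len r ∷ map len rs′) 0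
          term x∈ = trans (G-moved (proj₁ merged) (proj₂ (proj₂ (proj₂ merged)))) (cong (λ l → K * Φ y (l ∷ map len rs′) 0) (proj₁ (proj₂ (proj₂ merged))))
            where
            merged = paste (decomposition-↭ (prep (d , c) e) R) x∈

      -- The successor x₀ of d is excluded, being the case of `cut-first`. The list u holds the
      -- points between x₀ and the current x, so the pieces are x₀ with u and x with what follows
      -- it.
      cut-sum : ∀ x₀ u v → c ≡ x₀ ∷ u ++ v → sumOver (G m) v ≡ K * splitSum y μ (length u) (length v)
      cut-sum x₀ u [] eq = sym (*-zeroʳ K)
      cut-sum x₀ u (x ∷ v) refl = trans (cong₂ _+_ (G-moved (proj₁ halves) (proj₂ halves))
          (trans (cut-sum x₀ (u ++ x ∷ []) v (cong (x₀ ∷_) (sym (++-assoc u (x ∷ []) v))))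
            (cong (λ l → K * splitSum y μ l (length v)) (trans (length-++ u) (ℕ.+-comm (length u) 1)))))
        (sym (*-distribˡ-+ K _ _))
        where
        halves = cut {b = x₀} {u = u} R

  factorial-step : ∀ l x → ι (l !) * (ι (suc l) * x) ≡ ι (suc l !) * x
  factorial-step l x = trans (solve 3 (λ a b x → a :* (b :* x) := b :* a :* x) refl (ι (l !)) (ι (suc l)) x) (cong (_* x) (sym (ι-* (suc l) (l !))))

  cycSeries-at : ∀ {κ d e es} c rs → (R : CycleDecomposition κ (d ∷ e ∷ es) ((d , c) ∷ rs)) →
    (∀ κ cs → CycleDecomposition κ (e ∷ es) cs → ∀ m →
      cycSeries (e ∷ es) κ m ≡ ι (length es !) * Φ (λ k → Y (suc (length (e ∷ es))) k m) (map len cs) 0) →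
    ∀ m → cycSeries (d ∷ e ∷ es) κ m ≡ ι (length (e ∷ es) !) * Φ (λ k → Y (suc (length (d ∷ e ∷ es))) k m) (suc (length c) ∷ map len rs) 0
  cycSeries-at {κ} {d} {e} {es} [] rs R IH m = begin
    cycSeries (d ∷ ds) κ m                                   ≡⟨ cycSeries-step m ⟩
    0ℚ + sumOver (G m) (concatMap elems rs)                  ≡⟨ +-identityˡ _ ⟩
    sumOver (G m) (concatMap elems rs)                       ≡⟨ paste-sum m ⟩
    K * (W (y m) μ 0 - V (y m) μ 0)                          ≡⟨ cong (K *_) (fixed-identity (pascal m) μ) ⟩
    K * (ι (sum μ) * Φ (y⁺ m) (1 ∷ μ) 0)                     ≡⟨ cong (λ z → K * (ι z * Φ (y⁺ m) (1 ∷ μ) 0)) size ⟩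
    K * (ι N * Φ (y⁺ m) (1 ∷ μ) 0)                           ≡⟨ factorial-step (length es) _ ⟩
    ι (N !) * Φ (y⁺ m) (1 ∷ μ) 0 ∎
    where open Step R IH
  cycSeries-at {κ} {d} {e} {es} (x ∷ c) rs R IH m = begin
    cycSeries (d ∷ ds) κ m
      ≡⟨ cycSeries-step m ⟩
    G m x + sumOver (G m) c + sumOver (G m) (concatMap elems rs)
      ≡⟨ cong₂ _+_ (cong₂ _+_ (G-fixed m (proj₁ (cut-first R)) (proj₂ (cut-first R))) (cut-sum m x [] c refl)) (paste-sum m) ⟩
    K * Φ (s m) (suc l ∷ μ) 0 + K * splitSum (y m) μ 0 l + K * (W (y m) μ 0 - V (y m) μ (suc l))
      ≡⟨ solve 4 (λ K a b c → K :* a :+ K :* b :+ K :* c := K :* (a :+ b :+ c)) refl K (Φ (s m) (suc l ∷ μ) 0) (splitSum (y m) μ 0 l) (W (y m) μ 0 - V (y m) μ (suc l)) ⟩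
    K * (Φ (s m) (suc l ∷ μ) 0 + splitSum (y m) μ 0 l + (W (y m) μ 0 - V (y m) μ (suc l)))
      ≡⟨ cong (K *_) (nonfixed-identity (pascal m) μ l mulT′) ⟩
    K * (ι (suc l ℕ.+ sum μ) * Φ (y⁺ m) (suc (suc l) ∷ μ) 0)
      ≡⟨ cong (λ z → K * (ι z * Φ (y⁺ m) (suc (suc l) ∷ μ) 0)) size ⟩
    K * (ι N * Φ (y⁺ m) (suc (suc l) ∷ μ) 0)
      ≡⟨ factorial-step (length es) _ ⟩
    ι (N !) * Φ (y⁺ m) (suc (suc l) ∷ μ) 0 ∎
    where
    open Step R IH
    l : ℕ
    l = length c
    mulT′ : ∀ j → s m j ≡ y⁺ m j + ι (suc (suc l ℕ.+ sum μ)) * y⁺ m (suc j) + ι j * y m j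
    mulT′ j = trans (Y-mulT (suc N) j m) (cong (λ z → y⁺ m j + ι (suc z) * y⁺ m (suc j) + ι j * y m j) (sym size))

  singleton-decomposition : ∀ {κ d} c rs → CycleDecomposition κ (d ∷ []) ((d , c) ∷ rs) → κ d ≡ d × c ≡ [] × rs ≡ []
  singleton-decomposition [] [] R with cycles R
  ... | end κd ∷ _ = κd , refl , refl
  singleton-decomposition (_ ∷ _) _ R with () ← ↭-empty-inv (decomposition-tail R)
  singleton-decomposition [] (_ ∷ _) R with () ← ↭-empty-inv (decomposition-tail R)

  cycSeries-singleton : ∀ {κ d} → κ d ≡ d → ∀ m → cycSeries (d ∷ []) κ m ≡ Y 1 0 m
  cycSeries-singleton {κ} {d} κd m = trans
    (cong (λ b → ι (count (λ σ → (bit b ℕ.+ 0) ≡ᵇ m) (_∷_ {A = A → A} id []))) (dec-true (κ d ≟ d) κd)) (table m)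
    where
    table : ∀ m → ι (count (λ σ → 1 ≡ᵇ m) (_∷_ {A = A → A} id [])) ≡ Y 1 0 m
    table zero = refl
    table (suc zero) = refl
    table (suc (suc m)) = refl

  cycSeries-eval : ∀ d ds κ cs → CycleDecomposition κ (d ∷ ds) cs → ∀ m →
    cycSeries (d ∷ ds) κ m ≡ ι (length ds !) * Φ (λ k → Y (suc (length (d ∷ ds))) k m) (map len cs) 0
  cycSeries-eval d ds κ cs R m = go ds (decomposition-at R (here refl))
    where
    go : ∀ ds →
      (∃ λ c → ∃ λ rs → CycleDecomposition κ (d ∷ ds) ((d , c) ∷ rs) × map len cs ↭ suc (length c) ∷ map len rs) →
      cycSeries (d ∷ ds) κ m ≡ ι (length ds !) * Φ (λ k → Y (suc (length (d ∷ ds))) k m) (map len cs) 0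
    -- For one point the right-hand side is `Y 2 0` minus `Y 2 1`, which Pascal's rule turns into
    -- `Y 1 0`, the polynomial t.
    go [] (c , rs , R₁ , eq) = trans (cycSeries-singleton {κ} (proj₁ triv) m) (trans (Y-pascal 1 0 m)
      (trans (sym (Φ-↭ _ (↭-trans eq (↭-reflexive (cong₂ (λ c rs → suc (length c) ∷ map len rs) (proj₁ (proj₂ triv)) (proj₂ (proj₂ triv))))) 0)) (sym (*-identityˡ _))))
      where
      triv = singleton-decomposition c rs R₁
    go (e ∷ es) (c , rs , R₁ , eq) = trans (cycSeries-at c rs R₁ (cycSeries-eval e es) m)
      (cong (ι (length (e ∷ es) !) *_) (sym (Φ-↭ _ eq 0)))

  -- The list `cyclesOn` is complete and free of repetitions

  swp-comm : ∀ a b → swp a b ≗ swp b a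
  swp-comm a b x = go (x ≟ a) (x ≟ b)
    where
    go : Dec (x ≡ a) → Dec (x ≡ b) → swp a b x ≡ swp b a x
    go (yes refl) _ = trans (swp-l x b) (sym (swp-r b x))
    go (no _) (yes refl) = trans (swp-r a x) (sym (swp-l x a))
    go (no x≢a) (no x≢b) = trans (swp-other x≢a x≢b) (sym (swp-other x≢b x≢a))

  -- This is `cycOn-∘` with the transposition as κ: it moves d, and deleting d from it leaves the
  -- identity.
  cycOn-∘swp : ∀ {d ds x σ} → d ∉ ds → x ≢ d → PermOn ds σ → cycOn (d ∷ ds) (σ ∘ swp x d) ≡ cycOn ds σ
  cycOn-∘swp {d} {ds} {x} {σ} d∉ x≢d (inj , fix) = trans (cycOn-∘ {ds = ds} inj (fix d∉) (swp x d)) (cong₂ ℕ._+_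
    (cong bit (dec-false (swp x d d ≟ d) (λ e → x≢d (trans (sym (swp-r x d)) e))))
    (cycOn-cong ds (λ y → cong σ (trans (cong (λ z → swp d z (swp x d y)) (swp-r x d))
      (trans (swp-comm d x (swp x d y)) (swp-involutive x d y))))))

  fixes-singleton : ∀ {d f} → PermOn (d ∷ []) f → f d ≡ d
  fixes-singleton {d} {f} (inj , fix) with f d ≟ d
  ... | yes e = e
  ... | no ne = inj (fix λ { (here e) → ne e })

  cyclesOn-cycOn : ∀ ds → Unique ds → All (λ σ → cycOn ds σ ≡ 1) (cyclesOn ds)
  cyclesOn-cycOn [] _ = []
  cyclesOn-cycOn (d ∷ []) _ = cong (λ b → bit b ℕ.+ 0) (dec-true (d ≟ d) refl) ∷ []
  cyclesOn-cycOn (d ∷ ds@(_ ∷ _)) u = all-concatMap _ ds λ x∈ → All.map⁺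
    (All.zipWith (λ { (P , e) → trans (cycOn-∘swp (∉-head u) (∈-tail-≢ u x∈) P) e }) (cyclesOn-perm ds , cyclesOn-cycOn ds (Unique-tail u)))

  cycOn-positive : ∀ {d ds f} → PermOn (d ∷ ds) f → 1 ≤ cycOn (d ∷ ds) f
  cycOn-positive {d} {[]} {f} P = ℕ.≤-reflexive (sym (cong (λ b → bit b ℕ.+ 0) (dec-true (f d ≟ d) (fixes-singleton P))))
  cycOn-positive {d} {e ∷ es} {f} (inj , fix) = ℕ.≤-trans (cycOn-positive (del-injective inj , del-fixesOutside inj fix)) (ℕ.m≤n+m (cycOn (e ∷ es) (del d f)) (bit (does (f d ≟ d))))

  untwist : ∀ {d ds x f} → f x ≡ d → PermOn (d ∷ ds) f → PermOn ds (f ∘ swp x d)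
  untwist {d} {ds} {x} {f} fx (inj , fix) = swp-injective x d ∘ inj , fix′
    where
    fix′ : FixesOutside ds (f ∘ swp x d)
    fix′ {y} y∉ with y ≟ d
    ... | yes refl = trans (cong f (swp-r x d)) fx
    ... | no y≢d = trans (cong f (swp-other y≢x y≢d)) fy
      where
      fy : f y ≡ y
      fy = fix λ { (here e) → y≢d e ; (there y∈) → y∉ y∈ }
      y≢x : y ≢ x
      y≢x refl = y≢d (trans (sym fy) fx)

  Complete : List A → Set
  Complete ds = ∀ {f} → PermOn ds f → cycOn ds f ≡ 1 → ∃ λ σ → σ ∈ cyclesOn ds × f ≗ σ

  complete-∷ : ∀ {d e es} → Unique (d ∷ e ∷ es) → Complete (e ∷ es) → ∀ {f x} → f x ≡ d → PermOn (d ∷ e ∷ es) f →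
    cycOn (d ∷ e ∷ es) f ≡ 1 → ∃ λ σ → σ ∈ cyclesOn (d ∷ e ∷ es) × f ≗ σ
  complete-∷ {d} {e} {es} u IH {f} {x} fx P@(inj , fix) one =
    σ ∘ swp x d , ∈-concatMap⁺ _ (Any.map (λ { refl → ∈-map⁺ (_∘ swp x d) σ∈ }) x∈) , λ y →
        trans (sym (cong f (swp-involutive x d y))) (f≗σ (swp x d y))
    where
    ds : List A
    ds = e ∷ es
    -- A fixed point d would be one cycle, and `cycOn-positive` would supply a second.
    x≢d : x ≢ d
    x≢d refl = ℕ.1+n≰n (ℕ.≤-trans (ℕ.+-mono-≤ (ℕ.≤-reflexive (sym (cong bit (dec-true (f d ≟ d) fx)))) (cycOn-positive (del-injective inj , del-fixesOutside inj fix)))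
      (ℕ.≤-reflexive one))
    x∈ : x ∈ ds
    x∈ with x ∈? ds
    ... | yes x∈ = x∈
    ... | no x∉ = contradiction (trans (sym (fix λ { (here e) → x≢d e ; (there x∈) → x∉ x∈ })) fx) x≢d
    P′ : PermOn ds (f ∘ swp x d)
    P′ = untwist fx P
    one′ : cycOn ds (f ∘ swp x d) ≡ 1
    one′ = trans (sym (cycOn-∘swp (∉-head u) x≢d P′)) (trans (cycOn-cong (d ∷ ds) (λ y → cong f (swp-involutive x d y))) one)
    found : ∃ λ σ → σ ∈ cyclesOn ds × f ∘ swp x d ≗ σ
    found = IH P′ one′
    σ = proj₁ found
    σ∈ = proj₁ (proj₂ found)
    f≗σ = proj₂ (proj₂ found)

  cyclesOn-complete : (∀ {f} → Inj f → ∀ y → ∃ λ x → f x ≡ y) → ∀ ds → Unique ds → Complete ds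
  cyclesOn-complete surj (d ∷ []) u {f} P _ = id , here refl , fixed
    where
    fixed : ∀ y → f y ≡ y
    fixed y with y ≟ d
    ... | yes refl = fixes-singleton P
    ... | no y≢d = proj₂ P λ { (here e) → y≢d e }
  cyclesOn-complete surj (d ∷ ds@(_ ∷ _)) u P one =
    complete-∷ u (cyclesOn-complete surj ds (Unique-tail u)) (proj₂ (surj (proj₁ P) d)) P one

  -- Pointwise, because the full cycles are still functions here; as vectors they are later compared
  -- by equality.
  Distinct : (A → A) → (A → A) → Set
  Distinct f g = ¬ (f ≗ g)

  ∘swp-distinct : ∀ {x d f g} → Distinct f g → Distinct (f ∘ swp x d) (g ∘ swp x d)
  ∘swp-distinct {x} {d} {f} {g} ne e = ne λ y →
    trans (sym (cong f (swp-involutive x d y))) (trans (e (swp x d y)) (cong g (swp-involutive x d y)))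

  cyclesOn-distinct : ∀ ds → Unique ds → AllPairs Distinct (cyclesOn ds)
  cyclesOn-distinct [] _ = []
  cyclesOn-distinct (d ∷ []) _ = [] ∷ []
  cyclesOn-distinct (d ∷ ds@(_ ∷ _)) u = AllPairs.concat⁺
    (All.map⁺ {f = h} (All.tabulate (λ _ → AllPairs.map⁺ (AllPairs.map ∘swp-distinct (cyclesOn-distinct ds (Unique-tail u))))))
    (AllPairs.map⁺ {f = h} (AllPairs.map across (Unique-tail u)))
    where
    h : A → List (A → A)
    h x = map (_∘ swp x d) (cyclesOn ds)
    across : ∀ {x x′} → x ≢ x′ → All (λ f → All (Distinct f) (h x′)) (h x)
    across {x} {x′} x≢x′ = All.map⁺ (All.map (λ Pσ → All.map⁺ (All.map (λ Pτ → apart Pσ Pτ) (cyclesOn-perm ds))) (cyclesOn-perm ds))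
      where
      d∉ = ∉-head u
      -- The first product sends x to σ d = d. If the products agree, x is also the predecessor of d
      -- in the second one, which is x′.
      apart : ∀ {σ τ} → PermOn ds σ → PermOn ds τ → Distinct (σ ∘ swp x d) (τ ∘ swp x′ d)
      apart {σ} {τ} (_ , fixσ) (injτ , fixτ) e = x≢x′ (swp-injective x′ d (trans τx (sym (swp-l x′ d))))
        where
        τx : swp x′ d x ≡ d
        τx = injτ (trans (sym (e x)) (trans (cong σ (swp-l x d)) (trans (fixσ d∉) (sym (fixτ d∉)))))

-- Cycles counted by orbit minima

iter-+ : ∀ {X : Set} (f : X → X) j k x → iter f (j ℕ.+ k) x ≡ iter f j (iter f k x)
iter-+ f zero k x = refl
iter-+ f (suc j) k x = cong f (iter-+ f j k x)

iter-fixed : ∀ {X : Set} {f : X → X} {x} → f x ≡ x → ∀ k → iter f k x ≡ x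
iter-fixed e zero = refl
iter-fixed {f = f} e (suc k) = trans (cong f (iter-fixed e k)) e

injective⇒surjective : ∀ {n} {f : Fin n → Fin n} → (∀ {x y} → f x ≡ f y → x ≡ y) → ∀ y → ∃ λ x → f x ≡ y
injective⇒surjective {suc n} {f} inj y with Fin.any? (λ x → f x Fin.≟ y)
... | yes found = found
... | no none = contradiction (Fin.injective⇒≤ (λ {a} {b} e → inj (Fin.punchOut-injective (miss a) (miss b) e))) ℕ.1+n≰n
  where
  miss : ∀ x → y ≢ f x
  miss x e = none (x , sym e)

module _ {n : ℕ} where
  open FullCycles (Fin._≟_ {n})

  iter-injective : ∀ {f : Fin n → Fin n} → Inj f → ∀ k → Inj (iter f k)
  iter-injective inj zero e = e
  iter-injective inj (suc k) e = iter-injective inj k (inj e)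

  -- Two of the iterates 0,...,n coincide, and injectivity cancels the common ones. The bound
  -- `r ≤ n` is what makes a test of n iterates conclusive.
  period : ∀ {f : Fin n → Fin n} → Inj f → ∀ i → ∃ λ r → 1 ≤ r × r ≤ n × iter f r i ≡ i
  period {f} inj i with Fin.pigeonhole (ℕ.n<1+n n) (λ j → iter f (toℕ j) i)
  ... | a , b , a<b , e = toℕ b ∸ toℕ a , ℕ.m<n⇒0<n∸m a<b , ℕ.≤-trans (ℕ.m∸n≤m (toℕ b) (toℕ a)) (ℕ.≤-pred (Fin.toℕ<n b)) ,
    iter-injective inj (toℕ a) (trans (sym (iter-+ f (toℕ a) (toℕ b ∸ toℕ a) i)) (trans (cong (λ k → iter f k i) (ℕ.m+[n∸m]≡n (ℕ.<⇒≤ a<b))) (sym e)))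

  OrbitMin : (Fin n → Fin n) → Fin n → Set
  OrbitMin f i = ∀ k → toℕ i ≤ toℕ (iter f k i)

  orbitMinᵇ : (Fin n → Fin n) → Fin n → Bool
  orbitMinᵇ f i = allB (λ k → toℕ i ≤ᵇ toℕ (iter f k i)) (upTo n)

  orbitMinᵇ⁺ : ∀ {f i} → OrbitMin f i → T (orbitMinᵇ f i)
  orbitMinᵇ⁺ h = allB⁺ _ (upTo n) (λ {k} _ → ℕ.≤⇒≤ᵇ (h k))

  -- `numCycles` inspects only the iterates below n; a later one equals the iterate r steps before
  -- it, for a period r.
  orbitMinᵇ⁻ : ∀ {f i} → Inj f → T (orbitMinᵇ f i) → OrbitMin f i
  orbitMinᵇ⁻ {f} {i} inj t with period inj i
  ... | r , 1≤r , r≤n , e = <-rec (λ k → toℕ i ≤ toℕ (iter f k i)) bound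
    where
    bound : ∀ k → (∀ {j} → j < k → toℕ i ≤ toℕ (iter f j i)) → toℕ i ≤ toℕ (iter f k i)
    bound k rec with k ℕ.<? n
    ... | yes k<n = ℕ.≤ᵇ⇒≤ (toℕ i) (toℕ (iter f k i)) (allB⁻ _ (upTo n) t (∈-upTo⁺ k<n))
    ... | no k≮n = subst (λ x → toℕ i ≤ toℕ x)
      (trans (cong (iter f (k ∸ r)) (sym e)) (trans (sym (iter-+ f (k ∸ r) r i)) (cong (λ j → iter f j i) (ℕ.m∸n+n≡m r≤k))))
      (rec (ℕ.∸-monoʳ-< 1≤r r≤k))
      where
      r≤k : r ≤ k
      r≤k = ℕ.≤-trans r≤n (ℕ.≮⇒≥ k≮n)

  -- The order is decreasing, so that each deletion removes the largest point left: it is an orbit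
  -- minimum only if it is fixed, and no other minimum depends on it.
  below : ∀ m → m ≤ n → List (Fin n)
  below zero _ = []
  below (suc m) m<n = fromℕ< m<n ∷ below m (ℕ.<⇒≤ m<n)

  ∈-below⁻ : ∀ m m≤n {i} → i ∈ below m m≤n → toℕ i < m
  ∈-below⁻ (suc m) m<n (here refl) = s≤s (ℕ.≤-reflexive (Fin.toℕ-fromℕ< m<n))
  ∈-below⁻ (suc m) m<n (there i∈) = ℕ.m<n⇒m<1+n (∈-below⁻ m (ℕ.<⇒≤ m<n) i∈)

  ∈-below⁺ : ∀ m m≤n {i} → toℕ i < m → i ∈ below m m≤n
  ∈-below⁺ (suc m) m<n {i} i<sm with ℕ.m≤n⇒m<n∨m≡n (ℕ.≤-pred i<sm)
  ... | inj₁ i<m = there (∈-below⁺ m (ℕ.<⇒≤ m<n) i<m)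
  ... | inj₂ i≡m = here (Fin.toℕ-injective (trans i≡m (sym (Fin.toℕ-fromℕ< m<n))))

  below-unique : ∀ m m≤n → Unique (below m m≤n)
  below-unique zero _ = []
  below-unique (suc m) m<n = All.tabulate (λ i∈ e → ℕ.<-irrefl (trans (cong toℕ (sym e)) (Fin.toℕ-fromℕ< m<n)) (∈-below⁻ m (ℕ.<⇒≤ m<n) i∈))
    ∷ below-unique m (ℕ.<⇒≤ m<n)

  module _ {f : Fin n → Fin n} (inj : Inj f) {d : Fin n} where

    del-orbit⁻ : ∀ {i} k → ∃ λ j → iter (del d f) k i ≡ iter f j i
    del-orbit⁻ zero = 0 , refl
    del-orbit⁻ {i} (suc k) with del-orbit⁻ {i} k
    ... | j , e with iter f j i Fin.≟ d
    ...   | yes y≡d = j , trans (cong (del d f) (trans e y≡d)) (trans (del-self d f) (sym y≡d))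
    ...   | no y≢d with f (iter f j i) Fin.≟ d
    ...     | yes fy≡d = suc (suc j) , trans (cong (del d f) e) (trans (del-pred {d} {f} fy≡d) (cong f (sym fy≡d)))
    ...     | no fy≢d = suc j , trans (cong (del d f) e) (del-other inj y≢d fy≢d)

    -- Deletion skips d and nothing else. When the orbit stands at d, the point f d already reached
    -- by `del d f` is recorded, as the induction resumes there.
    del-orbit⁺ : ∀ {i} → i ≢ d → ∀ k → (∃ λ j → iter (del d f) j i ≡ iter f k i) ⊎ (iter f k i ≡ d × ∃ λ j → iter (del d f) j i ≡ f d)
    del-orbit⁺ i≢d zero = inj₁ (0 , refl)
    del-orbit⁺ {i} i≢d (suc k) with del-orbit⁺ i≢d k
    ... | inj₂ (y≡d , j , e) = inj₁ (j , trans e (cong f (sym y≡d)))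
    ... | inj₁ (j , e) with f (iter f k i) Fin.≟ d
    ...   | yes fy≡d = inj₂ (fy≡d , suc j , trans (cong (del d f) e) (del-pred {d} {f} fy≡d))
    ...   | no fy≢d = inj₁ (suc j , trans (cong (del d f) e) (del-other inj y≢d fy≢d))
      where
      y≢d : iter f k i ≢ d
      y≢d y≡d = i≢d (iter-injective (del-injective inj) j (trans (trans e y≡d) (sym (iter-fixed (del-self d f) j))))

    -- The orbit of i can lose only d, which is larger than i.
    orbitMin-del : ∀ {i} → toℕ i < toℕ d → orbitMinᵇ f i ≡ orbitMinᵇ (del d f) i
    orbitMin-del {i} i<d = T-ext
      (λ t → orbitMinᵇ⁺ (λ k → subst (λ x → toℕ i ≤ toℕ x) (sym (proj₂ (del-orbit⁻ k))) (orbitMinᵇ⁻ inj t (proj₁ (del-orbit⁻ k)))))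
      (λ t → orbitMinᵇ⁺ (λ k → lower t k (del-orbit⁺ (λ { refl → ℕ.<-irrefl refl i<d }) k)))
      where
      lower : T (orbitMinᵇ (del d f) i) → ∀ k → _ → toℕ i ≤ toℕ (iter f k i)
      lower t k (inj₁ (j , e)) = subst (λ x → toℕ i ≤ toℕ x) e (orbitMinᵇ⁻ (del-injective inj) t j)
      lower t k (inj₂ (e , _)) = subst (λ x → toℕ i ≤ toℕ x) (sym e) (ℕ.<⇒≤ i<d)

  count-∷ : ∀ (P : Fin n → Bool) x xs → count P (x ∷ xs) ≡ bit (P x) ℕ.+ count P xs
  count-∷ P x xs with P x
  ... | true = refl
  ... | false = refl

  orbitMin-max : ∀ {m} m<n {f} → PermOn (below (suc m) m<n) f → orbitMinᵇ f (fromℕ< m<n) ≡ does (f (fromℕ< m<n) Fin.≟ fromℕ< m<n)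
  orbitMin-max {m} m<n {f} (inj , fix) with f (fromℕ< m<n) Fin.≟ fromℕ< m<n
  ... | yes e = T-ext _ (λ _ → orbitMinᵇ⁺ {f} (λ k → ℕ.≤-reflexive (cong toℕ (sym (iter-fixed e k)))))
  ... | no ne = T-ext (λ t → ne (inj (fix λ fd∈ → ne (Fin.toℕ-injective (ℕ.≤-antisym
      (ℕ.≤-trans (ℕ.≤-pred (∈-below⁻ (suc m) m<n fd∈)) (ℕ.≤-reflexive (sym (Fin.toℕ-fromℕ< m<n)))) (orbitMinᵇ⁻ inj t 1)))))) (λ ())

  count-orbitMin : ∀ m m≤n {f} → PermOn (below m m≤n) f → count (orbitMinᵇ f) (below m m≤n) ≡ cycOn (below m m≤n) f
  count-orbitMin zero _ _ = refl
  count-orbitMin (suc m) m<n {f} P@(inj , fix) = trans (count-∷ (orbitMinᵇ f) (fromℕ< m<n) ds) (cong₂ ℕ._+_ (cong bit (orbitMin-max m<n P))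
    (trans (count-cong (All.tabulate (λ {i} i∈ → orbitMin-del inj (ℕ.<-≤-trans (∈-below⁻ m (ℕ.<⇒≤ m<n) i∈) (ℕ.≤-reflexive (sym (Fin.toℕ-fromℕ< m<n)))))))
      (count-orbitMin m (ℕ.<⇒≤ m<n) (del-injective inj , del-fixesOutside inj fix))))
    where
    ds : List (Fin n)
    ds = below m (ℕ.<⇒≤ m<n)

  below-all : ∀ i → i ∈ below n ℕ.≤-refl
  below-all i = ∈-below⁺ n ℕ.≤-refl (Fin.toℕ<n i)

  numCycles-cycOn : ∀ {f : Fin n → Fin n} → Inj f → numCycles f ≡ cycOn (below n ℕ.≤-refl) f
  numCycles-cycOn {f} inj = trans
    (count-↭ (orbitMinᵇ f) (set⇒↭ (Unique.allFin⁺ n) (below-unique n ℕ.≤-refl) (λ {i} _ → below-all i) (λ {i} _ → ∈-allFin i)))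
    (count-orbitMin n ℕ.≤-refl (inj , λ i∉ → contradiction (below-all _) i∉))

-- Permutations given in cycle notation

next : ℕ → ℕ → List ℕ → ℕ
next h x [] = x
next h x (a ∷ []) = if x ≡ᵇ a then h else x
next h x (a ∷ b ∷ l) = if x ≡ᵇ a then b else next h x (b ∷ l)

-- The local function of cycleFun has no name here: abstracting h ∷ t in the goal lets the left-hand side
-- of go-next be inferred.
mutual
  cycleFun-next : ∀ h t x → cycleFun (h ∷ t) x ≡ next h x (h ∷ t)
  cycleFun-next h t x with h ∷ t
  ... | l = go-next h t x l

  go-next : ∀ h t x l → _ ≡ next h x l
  go-next h t x [] = refl
  go-next h t x (a ∷ []) = refl
  go-next h t x (a ∷ b ∷ l) = cong (if x ≡ᵇ a then b else_) (go-next h t x (b ∷ l))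

≡ᵇ-refl : ∀ x → (x ≡ᵇ x) ≡ true
≡ᵇ-refl zero = refl
≡ᵇ-refl (suc x) = ≡ᵇ-refl x

≢⇒≡ᵇ-false : ∀ {x y} → x ≢ y → (x ≡ᵇ y) ≡ false
≢⇒≡ᵇ-false {x} {y} x≢y = T-ext (x≢y ∘ ℕ.≡ᵇ⇒≡ x y) (λ ())

next-skip : ∀ h x u a l → x ∉ u → next h x (u ++ a ∷ l) ≡ next h x (a ∷ l)
next-skip h x [] a l _ = refl
next-skip h x (y ∷ []) a l x∉ = cong (if_then a else next h x (a ∷ l)) (≢⇒≡ᵇ-false (x∉ ∘ here))
next-skip h x (y ∷ z ∷ u) a l x∉ = trans (cong (if_then z else next h x (z ∷ u ++ a ∷ l)) (≢⇒≡ᵇ-false (x∉ ∘ here)))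
  (next-skip h x (z ∷ u) a l (x∉ ∘ there))

next-head : ∀ h a b l → next h a (a ∷ b ∷ l) ≡ b
next-head h a b l = cong (if_then b else next h a (b ∷ l)) (≡ᵇ-refl a)

next-last : ∀ h a → next h a (a ∷ []) ≡ h
next-last h a = cong (if_then h else a) (≡ᵇ-refl a)

∈-interval⁻ : ∀ a b {k} → k ∈ interval a b → a ≤ k × k < b
∈-interval⁻ a b k∈ with ∈-map⁻ (a ℕ.+_) k∈
... | i , i∈ , refl = ℕ.m≤m+n a i , ℕ.≤-trans (ℕ.≤-reflexive (sym (ℕ.+-suc a i))) (ℕ.≤-trans (ℕ.+-monoʳ-≤ a i<) (ℕ.≤-reflexive (ℕ.m+[n∸m]≡n a≤b)))
  where
  i< : i < b ∸ a
  i< = ∈-upTo⁻ i∈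
  a≤b : a ≤ b
  a≤b = ℕ.<⇒≤ (ℕ.m∸n≢0⇒n<m (λ e → ℕ.<⇒≱ i< (ℕ.≤-trans (ℕ.≤-reflexive e) z≤n)))

∈-interval⁺ : ∀ {a b k} → a ≤ k → k < b → k ∈ interval a b
∈-interval⁺ {a} {b} {k} a≤k k<b = subst (_∈ interval a b) (ℕ.m+[n∸m]≡n a≤k) (∈-map⁺ (a ℕ.+_) (∈-upTo⁺ (ℕ.∸-monoˡ-< k<b a≤k)))

interval-unique : ∀ a b → Unique (interval a b)
interval-unique a b = Unique.map⁺ (ℕ.+-cancelˡ-≡ a _ _) (Unique.upTo⁺ (b ∸ a))

length-interval : ∀ a b → length (interval a b) ≡ b ∸ a
length-interval a b = trans (length-map (a ℕ.+_) (upTo (b ∸ a))) (length-upTo (b ∸ a))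

label : ∀ {n} → Fin n → ℕ
label i = suc (toℕ i)

label-injective : ∀ {n} {i j : Fin n} → label i ≡ label j → i ≡ j
label-injective e = Fin.toℕ-injective (ℕ.suc-injective e)

onLabels-label : ∀ {n} f {i j : Fin n} → f (label i) ≡ label j → onLabels n f i ≡ j
onLabels-label {n} f {i} {j} e with f (suc (toℕ i)) ∸ 1 <? n
... | yes lt = Fin.toℕ-injective (trans (Fin.toℕ-fromℕ< lt) (cong (_∸ 1) e))
... | no nlt = contradiction (subst (_< n) (sym (cong (_∸ 1) e)) (Fin.toℕ<n j)) nlt

unlabel : ∀ {n} ks → (∀ {k} → k ∈ ks → 1 ≤ k × k ≤ n) → ∃ λ (is : List (Fin n)) → map label is ≡ ks
unlabel [] _ = [] , refl
unlabel (zero ∷ ks) h with () ← proj₁ (h (here refl))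
unlabel (suc k ∷ ks) h with unlabel ks (h ∘ there)
... | is , e = fromℕ< (proj₂ (h (here refl))) ∷ is , cong₂ _∷_ (cong suc (Fin.toℕ-fromℕ< (proj₂ (h (here refl))))) e

module _ {n : ℕ} where
  open FullCycles (Fin._≟_ {n})

  -- The prefix u holds the entries already passed. As entries are distinct, a is not among them,
  -- and the search made by `cycleFun` stops at this occurrence of a.
  cycleFun-path : ∀ h t → Unique (h ∷ t) → ∀ u a l → h ∷ t ≡ u ++ a ∷ l → Path (onLabels n (cycleFun (map label (h ∷ t)))) a l h
  cycleFun-path h t uniq u a l split = go l refl
    where
    κ : Fin n → Fin n
    κ = onLabels n (cycleFun (map label (h ∷ t)))
    a∉u : label a ∉ map label u
    a∉u a∈ with ∈-map⁻ label a∈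
    ... | a′ , a′∈ , e = disjoint u (subst Unique split uniq) a′∈ (label-injective e)
      where
      disjoint : ∀ u → Unique (u ++ a ∷ l) → a′ ∈ u → a ≢ a′
      disjoint (x ∷ u) (x∉ ∷ _) (here refl) refl = All.lookup x∉ (∈-++⁺ʳ u (here refl)) refl
      disjoint (x ∷ u) (_ ∷ us) (there a′∈) = disjoint u us a′∈
    value : cycleFun (map label (h ∷ t)) (label a) ≡ next (label h) (label a) (label a ∷ map label l)
    value = trans (cycleFun-next (label h) (map label t) (label a)) (trans
      (cong (next (label h) (label a)) (trans (cong (map label) split) (map-++ label u (a ∷ l))))
      (next-skip (label h) (label a) (map label u) (label a) (map label l) a∉u))
    go : ∀ l′ → l ≡ l′ → Path κ a l′ h
    go [] refl = end (onLabels-label _ (trans value (next-last (label h) (label a))))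
    go (b ∷ l′) refl = step (onLabels-label _ (trans value (next-head (label h) (label a) (label b) (map label l′))))
      (cycleFun-path h t uniq (u ++ a ∷ []) b l′ (trans split (sym (++-assoc u (a ∷ []) (b ∷ l′)))))

  path-preimage : ∀ {κ a l b} → Path κ a l b → ∀ {y} → y ∈ l → ∃ λ x → κ x ≡ y
  path-preimage (step e p) (here refl) = _ , e
  path-preimage (step e p) (there y∈) = path-preimage p y∈

  path-last : ∀ {κ a l b} → Path κ a l b → ∃ λ x → κ x ≡ b
  path-last (end e) = _ , e
  path-last (step _ p) = path-last p

  -- A section of f is injective, hence surjective, hence a two-sided inverse. For a cycle,
  -- surjectivity is immediate: every entry is the target of an arrow.
  surjective⇒injective : ∀ {f : Fin n → Fin n} → (∀ y → ∃ λ x → f x ≡ y) → Inj f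
  surjective⇒injective {f} surj {x} {y} e with injective⇒surjective g-inj x | injective⇒surjective g-inj y
    where
    g : Fin n → Fin n
    g = proj₁ ∘ surj
    g-inj : ∀ {x y} → g x ≡ g y → x ≡ y
    g-inj {x} {y} eq = trans (sym (proj₂ (surj x))) (trans (cong f eq) (proj₂ (surj y)))
  ... | x′ , refl | y′ , refl = cong (proj₁ ∘ surj) (trans (sym (proj₂ (surj x′))) (trans e (proj₂ (surj y′))))

  cycleFun-decomposition : ∀ h t → Unique (h ∷ t) → (∀ i → i ∈ h ∷ t) →
    CycleDecomposition (onLabels n (cycleFun (map label (h ∷ t)))) (below n ℕ.≤-refl) ((h , t) ∷ [])
  cycleFun-decomposition h t u all = record
    { injective = surjective⇒injective preimage ; unique = below-unique n ℕ.≤-refl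
    ; covers = ↭-trans (↭-reflexive (++-identityʳ (h ∷ t))) (set⇒↭ u (below-unique n ℕ.≤-refl) (λ {i} _ → below-all i) (λ {i} _ → all i))
    ; cycles = p ∷ [] }
    where
    κ : Fin n → Fin n
    κ = onLabels n (cycleFun (map label (h ∷ t)))
    p : Path κ h t h
    p = cycleFun-path h t u [] h t refl
    preimage : ∀ y → ∃ λ x → κ x ≡ y
    preimage y with all y
    ... | here refl = path-last p
    ... | there y∈ = path-preimage p y∈

-- The cycle C_p

module CpCycles (M : ℕ) where
  N n : ℕ
  N = suc M
  n = suc N
  open FullCycles (Fin._≟_ {n})

  last penult : Fin n
  last = fromℕ< {N} ℕ.≤-refl
  penult = fromℕ< {M} (ℕ.<⇒≤ (ℕ.≤-refl {n}))

  toℕ-last : toℕ last ≡ N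
  toℕ-last = Fin.toℕ-fromℕ< {N} ℕ.≤-refl

  toℕ-penult : toℕ penult ≡ M
  toℕ-penult = Fin.toℕ-fromℕ< {M} (ℕ.<⇒≤ (ℕ.≤-refl {n}))

  -- Here p is the root jump minus one: `b ∷ u` carries the labels 1,...,p and v the labels
  -- p+1,...,N-1. The cycle starts at `last` and is displayed around `penult`, in the form required
  -- by `cut`.
  Cp-decomposition : ∀ p → 1 ≤ p → p < N → ∃ λ b → ∃ λ u → ∃ λ v → length (b ∷ u) ≡ p × length (penult ∷ v) ≡ N ∸ p ×
    CycleDecomposition (Cp n (suc p)) (below n ℕ.≤-refl) ((last , b ∷ u ++ penult ∷ v) ∷ [])
  Cp-decomposition p 1≤p p<N with unlabel {n} (interval 1 (suc p)) (λ k∈ → proj₁ (∈-interval⁻ 1 (suc p) k∈) , ℕ.≤-trans (ℕ.<⇒≤ (proj₂ (∈-interval⁻ 1 (suc p) k∈))) (ℕ.m≤n⇒m≤1+n p<N))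
    | unlabel {n} (interval (suc p) N) (λ k∈ → ℕ.≤-trans (s≤s z≤n) (proj₁ (∈-interval⁻ (suc p) N k∈)) , ℕ.≤-trans (ℕ.<⇒≤ (proj₂ (∈-interval⁻ (suc p) N k∈))) (ℕ.n≤1+n N))
  ... | [] , e₁ | v , e₂ = contradiction (trans (cong length e₁) (length-interval 1 (suc p))) (ℕ.<⇒≢ 1≤p)
  ... | b ∷ u , e₁ | v , e₂ = b , u , v ,
      trans (sym (length-map label (b ∷ u))) (trans (cong length e₁) (length-interval 1 (suc p))) ,
      trans (cong suc (trans (sym (length-map label v)) (trans (cong length e₂) (length-interval (suc p) N)))) (sym (ℕ.+-∸-assoc 1 p<N)) ,
      subst (λ ls → CycleDecomposition (onLabels n (cycleFun ls)) (below n ℕ.≤-refl) ((last , b ∷ u ++ penult ∷ v) ∷ []))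
        labels (cycleFun-decomposition last (b ∷ u ++ penult ∷ v) uniq all)
    where
    ls : List ℕ
    ls = n ∷ (interval 1 (suc p) ++ (N ∷ interval (suc p) N))
    labels : map label (last ∷ b ∷ u ++ penult ∷ v) ≡ ls
    labels = cong₂ _∷_ (cong suc toℕ-last) (trans (map-++ label (b ∷ u) (penult ∷ v)) (cong₂ _++_ e₁ (cong₂ _∷_ (cong suc toℕ-penult) e₂)))
    ls-unique : Unique ls
    ls-unique = All.tabulate bounded ∷ Unique.++⁺ (interval-unique 1 (suc p))
      (All.tabulate (λ k∈ e → ℕ.<-irrefl (sym e) (proj₂ (∈-interval⁻ (suc p) N k∈))) ∷ interval-unique (suc p) N) apart
      where
      bounded : ∀ {k} → k ∈ interval 1 (suc p) ++ (N ∷ interval (suc p) N) → n ≢ k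
      bounded k∈ refl with ∈-++⁻ (interval 1 (suc p)) k∈
      ... | inj₁ k∈₁ = ℕ.<-asym (ℕ.<-≤-trans (proj₂ (∈-interval⁻ 1 (suc p) k∈₁)) p<N) (ℕ.n<1+n N)
      ... | inj₂ (here e) = ℕ.<-irrefl (sym e) (ℕ.n<1+n N)
      ... | inj₂ (there k∈₂) = ℕ.<-asym (proj₂ (∈-interval⁻ (suc p) N k∈₂)) (ℕ.n<1+n N)
      apart : ∀ {k} → ¬ (k ∈ interval 1 (suc p) × k ∈ N ∷ interval (suc p) N)
      apart (k∈₁ , here refl) = ℕ.<-irrefl refl (ℕ.<-≤-trans (proj₂ (∈-interval⁻ 1 (suc p) k∈₁)) p<N)
      apart (k∈₁ , there k∈₂) = ℕ.<-irrefl refl (ℕ.<-≤-trans (proj₂ (∈-interval⁻ 1 (suc p) k∈₁)) (proj₁ (∈-interval⁻ (suc p) N k∈₂)))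
    uniq : Unique (last ∷ b ∷ u ++ penult ∷ v)
    uniq = AllPairs.map (λ ne e → ne (cong label e)) (AllPairs.map⁻ (subst Unique (sym labels) ls-unique))
    all : ∀ i → i ∈ last ∷ b ∷ u ++ penult ∷ v
    all i with ∈-map⁻ label (subst (label i ∈_) (sym labels) member)
      where
      member : label i ∈ ls
      member with ℕ.m≤n⇒m<n∨m≡n (Fin.toℕ<n i)
      ... | inj₂ e = here e
      ... | inj₁ i<N with ℕ.m≤n⇒m<n∨m≡n (ℕ.≤-pred i<N)
      ...   | inj₂ e = there (∈-++⁺ʳ (interval 1 (suc p)) (here e))
      ...   | inj₁ si<N with label i ℕ.<? suc p
      ...     | yes k<p = there (∈-++⁺ˡ (∈-interval⁺ (s≤s z≤n) k<p))
      ...     | no k≮p = there (∈-++⁺ʳ (interval 1 (suc p)) (there (∈-interval⁺ (ℕ.≮⇒≥ k≮p) si<N)))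
    ... | j , j∈ , e = subst (_∈ _) (sym (label-injective e)) j∈

-- Enumeration of vectors and the tests in `isDipole`

concatMap-cartesian : ∀ {X Z W : Set} (f : X → Z → W) xs ys → concatMap (λ x → map (f x) ys) xs ≡ cartesianProductWith f xs ys
concatMap-cartesian f [] ys = refl
concatMap-cartesian f (x ∷ xs) ys = cong (map (f x) ys ++_) (concatMap-cartesian f xs ys)

allVecs-unique : ∀ n k → Unique (allVecs n k)
allVecs-unique n zero = [] ∷ []
allVecs-unique n (suc k) = subst Unique (sym (concatMap-cartesian _∷_ (allFin n) (allVecs n k)))
  (Unique.cartesianProductWith⁺ _∷_ Vec.∷-injective (Unique.allFin⁺ n) (allVecs-unique n k))

allVecs-complete : ∀ {n k} (v : Vec (Fin n) k) → v ∈ allVecs n k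
allVecs-complete [] = here refl
allVecs-complete {n} {suc k} (i ∷ v) = subst (i ∷ v ∈_) (sym (concatMap-cartesian _∷_ (allFin n) (allVecs n k)))
  (∈-cartesianProductWith⁺ _∷_ (∈-allFin i) (allVecs-complete v))

count-∧ : ∀ {X : Set} (P Q : X → Bool) xs → count (λ x → P x ∧ Q x) xs ≡ count Q (filter (T? ∘ P) xs)
count-∧ P Q [] = refl
count-∧ P Q (x ∷ xs) with P x
... | true = cong (λ c → if Q x then suc c else c) (count-∧ P Q xs)
... | false = count-∧ P Q xs

T-if⁺ : ∀ {a b} → (T a → T b) → T (if a then b else true)
T-if⁺ {true} h = h _
T-if⁺ {false} h = _

T-if⁻ : ∀ {a b} → T (if a then b else true) → T a → T b
T-if⁻ {true} t _ = t

isPerm⁺ : ∀ {n} {f : Fin n → Fin n} → (∀ {x y} → f x ≡ f y → x ≡ y) → T (isPerm f)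
isPerm⁺ {n} {f} inj = allB⁺ _ (allFin n) λ {i} _ → allB⁺ _ (allFin n) λ {j} _ →
  T-if⁺ λ t → ℕ.≡⇒≡ᵇ (toℕ i) (toℕ j) (cong toℕ (inj (Fin.toℕ-injective (ℕ.≡ᵇ⇒≡ (toℕ (f i)) (toℕ (f j)) t))))

isPerm⁻ : ∀ {n} {f : Fin n → Fin n} → T (isPerm f) → ∀ {x y} → f x ≡ f y → x ≡ y
isPerm⁻ {n} {f} t {i} {j} e = Fin.toℕ-injective (ℕ.≡ᵇ⇒≡ (toℕ i) (toℕ j)
  (T-if⁻ (allB⁻ _ (allFin n) (allB⁻ _ (allFin n) t (∈-allFin i)) (∈-allFin j)) (ℕ.≡⇒≡ᵇ (toℕ (f i)) (toℕ (f j)) (cong toℕ e))))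

maps⁺ : ∀ {n a b} {i j : Fin n} {f : Fin n → Fin n} → toℕ i ≡ a → toℕ j ≡ b → f i ≡ j →
  T (allB (λ k → if toℕ k ≡ᵇ a then toℕ (f k) ≡ᵇ b else true) (allFin n))
maps⁺ {n} {i = i} {j} {f} refl refl refl = allB⁺ _ (allFin n) λ {k} _ →
  T-if⁺ λ t → ℕ.≡⇒≡ᵇ (toℕ (f k)) (toℕ (f i)) (cong (toℕ ∘ f) (Fin.toℕ-injective (ℕ.≡ᵇ⇒≡ (toℕ k) (toℕ i) t)))

maps⁻ : ∀ {n a b} {i j : Fin n} {f : Fin n → Fin n} → toℕ i ≡ a → toℕ j ≡ b →
  T (allB (λ k → if toℕ k ≡ᵇ a then toℕ (f k) ≡ᵇ b else true) (allFin n)) → f i ≡ j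
maps⁻ {n} {i = i} {j} {f} refl refl t = Fin.toℕ-injective (ℕ.≡ᵇ⇒≡ (toℕ (f i)) (toℕ j)
  (T-if⁻ (allB⁻ _ (allFin n) t (∈-allFin i)) (ℕ.≡⇒≡ᵇ (toℕ i) (toℕ i) refl)))

-- Counting dipoles

module Count (M : ℕ) where
  open CpCycles M
  open FullCycles (Fin._≟_ {n})

  rest full : List (Fin n)
  rest = below N (ℕ.<⇒≤ (ℕ.≤-refl {n}))
  full = below n ℕ.≤-refl

  last∉rest : last ∉ rest
  last∉rest = ∉-head (below-unique n ℕ.≤-refl)

  penult∈rest : penult ∈ rest
  penult∈rest = here refl

  penult≢last : penult ≢ last
  penult≢last = ∈-tail-≢ (below-unique n ℕ.≤-refl) penult∈rest

  rest-unique : Unique rest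
  rest-unique = below-unique N (ℕ.<⇒≤ (ℕ.≤-refl {n}))

  fullCycle : Vec (Fin n) n → Bool
  fullCycle v = isPerm (lookup v) ∧ (numCycles (lookup v) ≡ᵇ 1)
    ∧ allB (λ i → if toℕ i ≡ᵇ (n ∸ 2) then toℕ (lookup v i) ≡ᵇ (n ∸ 1) else true) (allFin n)

  -- As σ fixes `last`, the product sends `penult` to `last`, which is the condition on the non-root
  -- jump; composing with the same transposition again recovers σ.
  toVec : (Fin n → Fin n) → Vec (Fin n) n
  toVec σ = Vec.tabulate (σ ∘ swp penult last)

  lookup-toVec : ∀ σ → lookup (toVec σ) ≗ σ ∘ swp penult last
  lookup-toVec σ = Vec.lookup∘tabulate (σ ∘ swp penult last)

  inj-≗ : ∀ {g h : Fin n → Fin n} → g ≗ h → Inj h → Inj g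
  inj-≗ eq inj {x} {y} e = inj (trans (sym (eq x)) (trans e (eq y)))

  toVec-injective : ∀ {σ} → Inj σ → Inj (lookup (toVec σ))
  toVec-injective {σ} inj = inj-≗ (lookup-toVec σ) (swp-injective penult last ∘ inj)

  fullCycle-toVec : ∀ {σ} → σ ∈ cyclesOn rest → T (fullCycle (toVec σ))
  fullCycle-toVec {σ} σ∈ = T-∧⁺ (isPerm⁺ (toVec-injective (proj₁ P))) (T-∧⁺ (ℕ.≡⇒≡ᵇ _ 1 one)
      (maps⁺ {f = lookup (toVec σ)} toℕ-penult toℕ-last
        (trans (lookup-toVec σ penult) (trans (cong σ (swp-l penult last)) (proj₂ P last∉rest)))))
    where
    P : PermOn rest σ
    P = All.lookup (cyclesOn-perm rest) σ∈
    one : numCycles (lookup (toVec σ)) ≡ 1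
    one = trans (numCycles-cycOn (toVec-injective (proj₁ P))) (trans (cycOn-cong full (lookup-toVec σ))
      (trans (cycOn-∘swp last∉rest penult≢last P) (All.lookup (cyclesOn-cycOn rest rest-unique) σ∈)))

  fullCycle⇒toVec : ∀ v → T (fullCycle v) → v ∈ map toVec (cyclesOn rest)
  fullCycle⇒toVec v t = subst (_∈ map toVec (cyclesOn rest)) (sym eq) (∈-map⁺ toVec (proj₁ (proj₂ found)))
    where
    t₁ = T-∧⁻ {isPerm (lookup v)} t
    t₂ = T-∧⁻ {numCycles (lookup v) ≡ᵇ 1} (proj₂ t₁)
    inj : Inj (lookup v)
    inj = isPerm⁻ (proj₁ t₁)
    ve : lookup v penult ≡ last
    ve = maps⁻ {f = lookup v} toℕ-penult toℕ-last (proj₂ t₂)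
    P : PermOn rest (lookup v ∘ swp penult last)
    P = untwist ve (inj , λ i∉ → contradiction (below-all _) i∉)
    v≗ : lookup v ≗ lookup v ∘ swp penult last ∘ swp penult last
    v≗ y = cong (lookup v) (sym (swp-involutive penult last y))
    one : cycOn rest (lookup v ∘ swp penult last) ≡ 1
    one = trans (sym (cycOn-∘swp last∉rest penult≢last P)) (trans (cycOn-cong full (sym ∘ v≗))
      (trans (sym (numCycles-cycOn inj)) (ℕ.≡ᵇ⇒≡ _ 1 (proj₁ t₂))))
    found : ∃ λ σ → σ ∈ cyclesOn rest × lookup v ∘ swp penult last ≗ σ
    found = cyclesOn-complete injective⇒surjective rest rest-unique P one
    eq : v ≡ toVec (proj₁ found)
    eq = trans (sym (Vec.tabulate∘lookup v)) (Vec.tabulate-cong (λ y → trans (v≗ y) (proj₂ (proj₂ found) (swp penult last y))))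

  toVec-unique : Unique (map toVec (cyclesOn rest))
  toVec-unique = AllPairs.map⁺ (AllPairs.map (λ {σ} {τ} ne eq → ∘swp-distinct ne (λ y →
    trans (sym (lookup-toVec σ y)) (trans (cong (λ v → lookup v y) eq) (lookup-toVec τ y)))) (cyclesOn-distinct rest rest-unique))

  fullCycles-↭ : filter (T? ∘ fullCycle) (allVecs n n) ↭ map toVec (cyclesOn rest)
  fullCycles-↭ = set⇒↭ (Unique.filter⁺ (T? ∘ fullCycle) (allVecs-unique n n)) toVec-unique
    (λ {v} v∈ → fullCycle⇒toVec v (proj₂ (∈-filter⁻ (T? ∘ fullCycle) {xs = allVecs n n} v∈)))
    from
    where
    from : ∀ {v} → v ∈ map toVec (cyclesOn rest) → v ∈ filter (T? ∘ fullCycle) (allVecs n n)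
    from v∈ with ∈-map⁻ toVec v∈
    ... | σ , σ∈ , refl = ∈-filter⁺ (T? ∘ fullCycle) (allVecs-complete (toVec σ)) (fullCycle-toVec σ∈)

  -- By associativity the transposition moves from the vertex rotation to C_p, leaving a sum over
  -- all cycles on `rest`.
  count-dipoles : ∀ p cyc → Inj (Cp n p) →
    count (isDipole n p cyc) (allVecs n n) ≡ count (λ σ → cyc (cycOn full (σ ∘ (swp penult last ∘ Cp n p)))) (cyclesOn rest)
  count-dipoles p cyc injC = begin
    count (isDipole n p cyc) (allVecs n n)
      ≡⟨ count-cong {xs = allVecs n n} (All.tabulate (λ {v} _ → regroup v)) ⟩
    count (λ v → fullCycle v ∧ faces v) (allVecs n n)
      ≡⟨ count-∧ fullCycle faces (allVecs n n) ⟩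
    count faces (filter (T? ∘ fullCycle) (allVecs n n))
      ≡⟨ count-↭ faces fullCycles-↭ ⟩
    count faces (map toVec (cyclesOn rest))
      ≡⟨ count-map faces toVec (cyclesOn rest) ⟩
    count (faces ∘ toVec) (cyclesOn rest)
      ≡⟨ count-cong (All.map (λ {σ} (P : PermOn rest σ) → cong cyc (trans (numCycles-cycOn (injC ∘ toVec-injective {σ} (proj₁ P)))
           (cycOn-cong full (λ x → lookup-toVec σ (Cp n p x))))) (cyclesOn-perm rest)) ⟩
    count (λ σ → cyc (cycOn full (σ ∘ (swp penult last ∘ Cp n p)))) (cyclesOn rest) ∎
    where
    open ≡-Reasoning
    faces : Vec (Fin n) n → Bool
    faces v = cyc (numCycles (λ x → lookup v (Cp n p x)))
    regroup : ∀ v → isDipole n p cyc v ≡ fullCycle v ∧ faces v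
    regroup v = sym (trans (∧-assoc (isPerm (lookup v)) _ (faces v)) (cong (isPerm (lookup v) ∧_) (∧-assoc (numCycles (lookup v) ≡ᵇ 1) _ (faces v))))

  faces-eval : ∀ {p b u v} → CycleDecomposition (Cp n (suc p)) full ((last , b ∷ u ++ penult ∷ v) ∷ []) → ∀ m →
    ι (count (isDipole n (suc p) (_≡ᵇ m)) (allVecs n n)) ≡ ι (M !) ℚ.* Φ (λ k → Y n k m) (length (b ∷ u) ∷ length (penult ∷ v) ∷ []) 0
  faces-eval {p} {b} {u} {v} R m = begin
    ι (count (isDipole n (suc p) (_≡ᵇ m)) (allVecs n n))
      ≡⟨ cong ι (count-dipoles (suc p) (_≡ᵇ m) (CycleDecomposition.injective R)) ⟩
    ι (count (λ σ → cycOn full (σ ∘ κ) ≡ᵇ m) (cyclesOn rest))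
      ≡⟨ cycOn-extend last∉rest κ m ⟩
    timesTIf (does (κ last Fin.≟ last)) (cycSeries rest (del last κ)) m
      -- The transposed C_p sends `last` to b, a different point, so no factor t arises.
      ≡⟨ cong (λ b → timesTIf b (cycSeries rest (del last κ)) m) (dec-false (κ last Fin.≟ last) (proj₁ halves)) ⟩
    cycSeries rest (del last κ) m
      ≡⟨ cycSeries-eval penult rest′ (del last κ) _ (proj₂ halves) m ⟩
    ι (length rest′ !) ℚ.* Φ (λ k → Y (suc (suc (length rest′))) k m) (length (b ∷ u) ∷ length (penult ∷ v) ∷ []) 0
      ≡⟨ cong (λ l → ι (l !) ℚ.* Φ (λ k → Y (suc (suc l)) k m) (length (b ∷ u) ∷ length (penult ∷ v) ∷ []) 0) (length-below M _) ⟩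
    ι (M !) ℚ.* Φ (λ k → Y n k m) (length (b ∷ u) ∷ length (penult ∷ v) ∷ []) 0 ∎
    where
    open ≡-Reasoning
    κ : Fin n → Fin n
    κ = swp penult last ∘ Cp n (suc p)
    rest′ : List (Fin n)
    rest′ = below M (ℕ.<⇒≤ (ℕ.<⇒≤ (ℕ.≤-refl {n})))
    halves : κ last ≢ last × CycleDecomposition (del last κ) rest ((b , u) ∷ (penult , v) ∷ [])
    halves = cut {b = b} {u = u} R
    length-below : ∀ m (m≤n : m ≤ n) → length (below m m≤n) ≡ m
    length-below zero _ = refl
    length-below (suc m) m<n = cong suc (length-below m (ℕ.<⇒≤ m<n))

  dipoles-by-faces : ∀ p → 1 ≤ p → p < N → ∀ m →
    ι (count (isDipole n (suc p) (_≡ᵇ m)) (allVecs n n)) ≡ ι (M !) ℚ.* Φ (λ k → Y n k m) (p ∷ N ∸ p ∷ []) 0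
  dipoles-by-faces p 1≤p p<N m = from (Cp-decomposition p 1≤p p<N)
    where
    from : (∃ λ b → ∃ λ u → ∃ λ v → length (b ∷ u) ≡ p × length (penult ∷ v) ≡ N ∸ p ×
      CycleDecomposition (Cp n (suc p)) full ((last , b ∷ u ++ penult ∷ v) ∷ [])) →
      ι (count (isDipole n (suc p) (_≡ᵇ m)) (allVecs n n)) ≡ ι (M !) ℚ.* Φ (λ k → Y n k m) (p ∷ N ∸ p ∷ []) 0
    from (b , u , v , len₁ , len₂ , R) = trans (faces-eval {p} {b} {u} {v} R m)
      (cong₂ (λ x y → ι (M !) ℚ.* Φ (λ k → Y n k m) (x ∷ y ∷ []) 0) len₁ len₂)

  isDipole-cong : ∀ p {P Q : ℕ → Bool} → (∀ c → P c ≡ Q c) → ∀ xs → count (isDipole n p P) xs ≡ count (isDipole n p Q) xs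
  isDipole-cong p {P} {Q} eq xs = count-cong {xs = xs} (All.tabulate (λ {v} _ → same v))
    where
    same : ∀ v → isDipole n p P v ≡ isDipole n p Q v
    same v = cong (λ b → isPerm (lookup v) ∧ (numCycles (lookup v) ≡ᵇ 1)
      ∧ allB (λ i → if toℕ i ≡ᵇ (n ∸ 2) then toℕ (lookup v i) ≡ᵇ (n ∸ 1) else true) (allFin n) ∧ b)
      (eq (numCycles (λ x → lookup v (Cp n p x))))

  isDipole-false : ∀ p xs → count (isDipole n p (λ _ → false)) xs ≡ 0
  isDipole-false p xs = trans (count-cong {xs = xs} (All.tabulate (λ {v} _ → same v))) (count-false xs)
    where
    same : ∀ v → isDipole n p (λ _ → false) v ≡ false
    same v = T-ext (λ t → proj₂ (T-∧⁻ (proj₂ (T-∧⁻ {numCycles (lookup v) ≡ᵇ 1} (proj₂ (T-∧⁻ {isPerm (lookup v)} t)))))) (λ ())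

  dipoleCount-coeff : ∀ p → 1 ≤ p → p < N → ∀ D → (∀ m → coeffℕ m D ≡ Φ (λ k → Y n k m) (p ∷ N ∸ p ∷ []) 0) →
    ∀ g → ι (dipoleCount n (suc p) g) ≡ ι (M !) ℚ.* coeff (+ n ℤ.- + (2 ℕ.* g)) D
  dipoleCount-coeff p 1≤p p<N D coeffs g = byGenus (2g ℕ.≤? n)
    where
    2g : ℕ
    2g = 2 ℕ.* g
    byGenus : Dec (2g ≤ n) → ι (dipoleCount n (suc p) g) ≡ ι (M !) ℚ.* coeff (+ n ℤ.- + 2g) D
    byGenus (yes 2g≤n) = trans (cong ι (isDipole-cong (suc p) sameTest (allVecs n n)))
      (trans (dipoles-by-faces p 1≤p p<N (n ∸ 2g)) (cong (ι (M !) ℚ.*_) (trans (sym (coeffs (n ∸ 2g)))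
        (cong (λ z → coeff z D) (sym (trans (ℤ.m-n≡m⊖n n 2g) (ℤ.⊖-≥ 2g≤n)))))))
      where
      sameTest : ∀ c → (c ℕ.+ 2g ≡ᵇ n) ≡ (c ≡ᵇ n ∸ 2g)
      sameTest c = T-ext
        (λ t → ℕ.≡⇒≡ᵇ c _ (trans (sym (ℕ.m+n∸n≡m c 2g)) (cong (_∸ 2g) (ℕ.≡ᵇ⇒≡ (c ℕ.+ 2g) n t))))
        (λ t → ℕ.≡⇒≡ᵇ (c ℕ.+ 2g) n (trans (cong (ℕ._+ 2g) (ℕ.≡ᵇ⇒≡ c _ t)) (ℕ.m∸n+n≡m 2g≤n)))
    -- For 2g > n no number of cycles passes the test, and `coeff` vanishes at a negative exponent.
    byGenus (no 2g≰n) = trans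
      (cong ι (trans (isDipole-cong (suc p) (λ c → T-ext (λ t → 2g≰n (ℕ.≤-trans (ℕ.m≤n+m 2g c) (ℕ.≤-reflexive (ℕ.≡ᵇ⇒≡ (c ℕ.+ 2g) n t)))) (λ ())) (allVecs n n))
        (isDipole-false (suc p) (allVecs n n))))
      (sym (trans (cong (ι (M !) ℚ.*_) negative) (ℚ.*-zeroʳ (ι (M !)))))
      where
      neg-coeff : ∀ k → 0 < k → coeff (ℤ.- + k) D ≡ ℚ.0ℚ
      neg-coeff (suc k) _ = refl
      negative : coeff (+ n ℤ.- + 2g) D ≡ ℚ.0ℚ
      negative = trans (cong (λ z → coeff z D) (trans (ℤ.m-n≡m⊖n n 2g) (ℤ.⊖-< (ℕ.≰⇒> 2g≰n)))) (neg-coeff (2g ∸ n) (ℕ.m<n⇒0<n∸m (ℕ.≰⇒> 2g≰n)))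

open import Data.Nat using (ℕ; _≤_; _<_; _*_; _∸_; _!)
open import Data.Integer using (+_; _-_)
open import Data.Rational using (ℚ)
open import Data.Product using (_×_)
open import Relation.Binary.PropositionalEquality using (_≡_)

mainTheorem9 : (n g p : ℕ) → 4 ≤ n →
    ((2 ≤ p → 2 * p ≤ n →
    fromℕq (dipoleCount n p g) ≡ fromℕq ((n ∸ 2) !) Data.Rational.* coeff (+ n - + (2 * g)) (D₁ n p))
    × (n < 2 * p → p ≤ n ∸ 1 →
    fromℕq (dipoleCount n p g) ≡ fromℕq ((n ∸ 2) !) Data.Rational.* coeff (+ n - + (2 * g)) (D₂ n p)))
mainTheorem9 (suc zero) g p (s≤s ())
mainTheorem9 (suc (suc M)) g zero _ = (λ ()) , (λ ())
mainTheorem9 (suc (suc M)) g (suc p) _ =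
    (λ { (s≤s 1≤p) 2p≤n → dipoleCount-coeff p 1≤p
           (ℕ.≤-trans (ℕ.≤-trans (ℕ.m≤n+m (suc p) p) (ℕ.+-monoʳ-≤ p (ℕ.m≤m+n (suc p) 0))) (ℕ.≤-pred 2p≤n))
           (D₁ (suc (suc M)) (suc p)) (λ m → D₁-coeff (suc M) p m 1≤p 2p≤n) g })
  , (λ n<2p p≤N → dipoleCount-coeff p (1≤p p n<2p) p≤N (D₂ (suc (suc M)) (suc p)) (λ m → D₂-coeff (suc M) p m n<2p p≤N) g)
  where
  open Count M
  -- A root jump of one would force n < 2.
  1≤p : ∀ p → suc (suc M) < 2 * suc p → 1 ≤ p
  1≤p zero (s≤s (s≤s ()))
  1≤p (suc p) _ = s≤s z≤n
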